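{- Let $p$ be a prime with $p\equiv 3\pmod 4$ and let $f$ be an admissible function on $\mathbb{F}_p$. If the $4$-graph $\mathcal{H}_f$ contains no copy of $\mathcal{H}(4)$ and has exactly $\frac{n}{16}\binom{n}{3}$ edges, where $n=p+1$, then $\mathcal{H}_f=\mathcal{H}_p$.
   Context: For an abelian group $A$ of odd order, $f:A\to\{0,\pm1\}$ is admissible if $f(a)=0$ iff $a=0$ and $f(-a)=-f(a)$ for all $a$. $T_f$ is the tournament on $A$ with $(x,y)$ an edge iff $f(y-x)=1$; $T_f^+$ adds a new vertex $\infty$ with $(x,\infty)$ an edge for every $x\in A$. For a tournament $T$, $e_T(x,y)=1$ if $(x,y)$ is an edge, $-1$ otherwise, and $g_T(x,y,z)=e_T(x,y)e_T(y,z)e_T(z,x)$ (an oriented two-graph). $\chi:\mathbb{F}_p\to\{0,\pm1\}$ is the quadratic character ($\chi(0)=0$, $\chi(x)=1$ for nonzero squares, $-1$ otherwise), which is admissible. $g_3:=g_{T_\chi^+}$ for $p=3$, i.e. the oriented two-graph of the cyclic triangle $0\to1\to2\to0$ augmented by a vertex $\infty$ with all edges directed into $\infty$. $\mathcal{H}_f$ is the $4$-graph on $\mathbb{F}_p\cup\{\infty\}$ whose edges are the $4$-sets $X$ with $g_{T_f^+}|_X\cong g_3$ (restriction to triples from $X$; isomorphism via a bijection preserving the function), and $\mathcal{H}_p:=\mathcal{H}_\chi$. $\mathcal{H}(4)$ is the $4$-graph on $5$ vertices with $3$ edges. -}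

module Defs where

open import Data.Nat as ℕ using (ℕ; zero; suc; NonZero; _+_; _∸_)
open import Data.Nat.DivMod using (_mod_)
open import Data.Fin as Fin using (Fin; zero; suc; toℕ)
open import Data.Fin.Properties using (any?; all?)
open import Data.Integer as ℤ using (ℤ; +_; -_)
open import Data.Bool using (if_then_else_)
open import Data.List as List using (List; []; _∷_; [_]; concatMap; filter; length; allFin)
open import Data.List.Relation.Unary.Linked using (Linked; linked?)
open import Data.List.Relation.Unary.Any using (Any) renaming (any? to anyL?)
open import Data.List.Relation.Unary.Unique.Propositional using (Unique)
open import Data.List.Relation.Unary.Unique.DecPropositional (Fin._≟_ {4}) using (unique?)
open import Data.Vec as Vec using (Vec; []; _∷_; lookup; toList; removeAt)
open import Data.Product using (Σ; ∃; _×_; _,_)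
open import Data.Sum using (_⊎_)
open import Relation.Nullary using (Dec; yes; no; ¬_; ¬?)
open import Relation.Nullary.Decidable using (⌊_⌋; _×-dec_; _→-dec_)
open import Relation.Binary.PropositionalEquality using (_≡_; _≢_)
open import Function using (_⇔_)

module _ (p : ℕ) .{{_ : NonZero p}} where

  _-ₚ_ : Fin p → Fin p → Fin p
  y -ₚ x = (toℕ y + (p ∸ toℕ x)) mod p

  negₚ : Fin p → Fin p
  negₚ x = (p ∸ toℕ x) mod p

  0ₚ : Fin p
  0ₚ = 0 mod p

  IsSquare : Fin p → Set
  IsSquare x = ∃ λ (y : Fin p) → ((toℕ y ℕ.* toℕ y) mod p) ≡ x

  isSquare? : (x : Fin p) → Dec (IsSquare x)
  isSquare? x = any? (λ y → ((toℕ y ℕ.* toℕ y) mod p) Fin.≟ x)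

  χ : Fin p → ℤ
  χ x = if ⌊ x Fin.≟ 0ₚ ⌋ then + 0 else (if ⌊ isSquare? x ⌋ then + 1 else - (+ 1))

  Admissible : (Fin p → ℤ) → Set
  Admissible f =
      (∀ a → f a ≡ + 0 ⊎ f a ≡ + 1 ⊎ f a ≡ - (+ 1))
    × (∀ a → (f a ≡ + 0 → a ≡ 0ₚ) × (a ≡ 0ₚ → f a ≡ + 0))
    × (∀ a → f (negₚ a) ≡ - f a)

  -- The tournament T_f^+ on F_p ∪ {∞}.  Vertex set: Fin (suc p), where
  -- zero is ∞ and (suc x) is the field element x.

  V : Set
  V = Fin (suc p)

  -- e_{T_f^+}(u , v) : 1 if (u , v) is an edge, -1 otherwise
  -- (the value on u = v is irrelevant; it is never used below).
  e⁺ : (Fin p → ℤ) → V → V → ℤ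
  e⁺ f zero    zero    = - (+ 1)
  e⁺ f zero    (suc y) = - (+ 1)
  e⁺ f (suc x) zero    = + 1
  e⁺ f (suc x) (suc y) = if ⌊ f (y -ₚ x) ℤ.≟ + 1 ⌋ then + 1 else - (+ 1)

  g⁺ : (Fin p → ℤ) → V → V → V → ℤ
  g⁺ f x y z = e⁺ f x y ℤ.* e⁺ f y z ℤ.* e⁺ f z x

g₃ : Fin 4 → Fin 4 → Fin 4 → ℤ
g₃ = g⁺ 3 (χ 3)

tuples : (k n : ℕ) → List (Vec (Fin n) k)
tuples zero    n = [ [] ]
tuples (suc k) n = concatMap (λ i → List.map (i ∷_) (tuples k n)) (allFin n)

IsSet : ∀ {k n} → Vec (Fin n) k → Set
IsSet v = Linked Fin._<_ (toList v)

isSet? : ∀ {k n} (v : Vec (Fin n) k) → Dec (IsSet v)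
isSet? v = linked? Fin._<?_ (toList v)

kSets : (k n : ℕ) → List (Vec (Fin n) k)
kSets k n = filter isSet? (tuples k n)

-- Isomorphism of the restriction of an oriented two-graph g to a 4-set X
-- with g₃: a bijection σ : X → Fin 4 (given as the list of images of the
-- elements of X, required to be duplicate-free) with
-- g₃(σ a, σ b, σ c) = g(a, b, c) for all distinct a, b, c ∈ X.

module _ {n : ℕ} (g : Fin n → Fin n → Fin n → ℤ) (X : Vec (Fin n) 4) where

  Preserves : Vec (Fin 4) 4 → Set
  Preserves σ = ∀ i j k → i ≢ j → j ≢ k → i ≢ k →
    g (lookup X i) (lookup X j) (lookup X k) ≡ g₃ (lookup σ i) (lookup σ j) (lookup σ k)

  preserves? : (σ : Vec (Fin 4) 4) → Dec (Preserves σ)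
  preserves? σ = all? λ i → all? λ j → all? λ k →
    ¬? (i Fin.≟ j) →-dec (¬? (j Fin.≟ k) →-dec (¬? (i Fin.≟ k) →-dec
      (g (lookup X i) (lookup X j) (lookup X k) ℤ.≟ g₃ (lookup σ i) (lookup σ j) (lookup σ k))))

  IsoToG₃ : Set
  IsoToG₃ = Any (λ σ → Unique (toList σ) × Preserves σ) (tuples 4 4)

  isoToG₃? : Dec IsoToG₃
  isoToG₃? = anyL? (λ σ → unique? (toList σ) ×-dec preserves? σ) (tuples 4 4)

module _ (p : ℕ) .{{_ : NonZero p}} (f : Fin p → ℤ) where

  EdgeH : Vec (V p) 4 → Set
  EdgeH X = IsoToG₃ (g⁺ p f) X

  edgeH? : (X : Vec (V p) 4) → Dec (EdgeH X)
  edgeH? X = isoToG₃? (g⁺ p f) X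

  numEdges : ℕ
  numEdges = length (filter edgeH? (kSets 4 (suc p)))

  edgesIn : Vec (V p) 5 → ℕ
  edgesIn Y = length (filter (λ i → edgeH? (removeAt Y i)) (allFin 5))

  -- H_f contains no copy of H(4) (4-graph on 5 vertices with 3 edges):
  -- no 5-set of vertices spans 3 or more edges.
  H4Free : Set
  H4Free = ∀ (Y : Vec (V p) 5) → IsSet Y → edgesIn Y ℕ.≤ 2

{-# OPTIONS --safe #-}
-- Let S be the Seidel matrix of T_f⁺ (zero diagonal, S_xy = ±1 according to the direction
-- of the edge). A 4-set is an edge of H_f exactly when its Pfaffian is ±3, and the Pfaffian
-- of any other 4-set is ±1. Summing squared Pfaffians, the number of edges becomes an affine
-- function of tr S⁴ = ‖S²‖², and n/16 · C(n,3) edges forces ‖S² + (n-1)I‖² = 0. The rows of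
-- S indexed by F_p then say that ∑_z f(z) f(y-z) ≡ 1 (mod p) for every y.
--
-- Write M_j = ∑ f(x) x^j. Multiplying by y^m and summing over y gives
-- ∑_k C(m,k) M_k M_{m-k} ≡ ∑_y y^m, which is 0 for m < p-1 and -1 for m = p-1. Hence
-- M_j ≡ 0 for j < h = (p-1)/2, and C(p-1,h) ≡ (-1)^h = -1 yields M_h² ≡ 1. By Euler's
-- criterion M_h ≡ ∑ f(x) χ(x), an integer congruent to ±1 that equals p-1 minus twice the
-- number of disagreements between f and χ; so f = χ or f = -χ. Negating f changes each
-- Pfaffian at most by sign.
module Submission where

open import Defs
open import Algebra using (CommutativeRing)
open import Data.Bool using (true; false; if_then_else_)
open import Data.Nat as ℕ using (ℕ; zero; suc; _!; NonZero; _%_)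
import Data.Nat.Properties as ℕ
import Data.Nat.DivMod as ℕ
import Data.Nat.Divisibility as ℕ
import Data.Nat.Tactic.RingSolver as ℕ-RingSolver
open import Data.Nat.Induction using (<-rec)
open import Data.Nat.Combinatorics using (_C_; nCk+nC[k+1]≡[n+1]C[k+1]; nC1≡n; nCn≡1; nCk≡n!/k![n-k]!; [n∸k]!k!∣n!)
open import Data.Nat.Primality using (Prime; euclidsLemma; prime⇒nonTrivial; prime⇒nonZero)
open import Data.Fin as Fin using (Fin; zero; suc; toℕ; fromℕ<; punchIn; punchOut)
open import Data.Fin.Patterns using (0F; 1F; 2F; 3F)
open import Data.Fin.Permutation using (Permutation′; permutation; inverseˡ)
open import Data.Fin.Properties as Fin using (all?; punchInᵢ≢i; punchIn-punchOut; toℕ<n; toℕ-injective; toℕ-fromℕ<)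
open import Data.Integer hiding (suc; _^_; _%_; NonZero)
open import Data.Integer.Properties
open import Data.Integer.Divisibility.Signed using (_∣_; divides; ∣⇒∣ᵤ; ∣ᵤ⇒∣; ∣m∣n⇒∣m+n; ∣m⇒∣-m; ∣n⇒∣m*n; ∣m⇒∣m*n)
open import Data.Integer.Tactic.RingSolver using (solve-∀)
open import Data.List as List using (List; []; _∷_; filter; length; concatMap)
open import Data.List.Relation.Unary.Linked using ([]; [-]; _∷_)
import Data.List.Relation.Unary.Any as Any
open import Data.Vec as Vec using (Vec; []; _∷_; lookup)
open import Data.Vec.Membership.Propositional using (_∈_)
open import Data.Vec.Membership.Propositional.Properties using (∈-map⁺)
open import Data.Vec.Relation.Unary.Any using (here; there)
open import Data.Product using (_×_; _,_; proj₁; proj₂; ∃)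
open import Data.Sum using (_⊎_; inj₁; inj₂; [_,_]′)
open import Data.Unit using (tt)
open import Function using (_∘_; id)
open import Level using (0ℓ)
open import Relation.Nullary using (Dec; yes; no; ¬_; does; contradiction)
open import Relation.Nullary.Decidable using (⌊_⌋; toWitness)
open import Relation.Binary.Definitions using (tri<; tri≈; tri>)
open import Relation.Binary.PropositionalEquality hiding (setoid)
open import Algebra.Properties.Semiring.Sum +-*-semiring
open import Algebra.Properties.Semiring.Exp +-*-semiring using (_^_; ^-homo-*)
open import Algebra.Properties.Semiring.Mult +-*-semiring using () renaming (_×_ to _·_)
import Algebra.Properties.CommutativeSemiring.Binomial +-*-commutativeSemiring as Binomial

ind : ∀ {a} {P : Set a} → Dec P → ℤ
ind P? = if does P? then 1ℤ else 0ℤ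

ind-⇔ : ∀ {a b} {P : Set a} {Q : Set b} (P? : Dec P) (Q? : Dec Q) → (P → Q) → (Q → P) → ind P? ≡ ind Q?
ind-⇔ (yes _) (yes _) _ _ = refl
ind-⇔ (no _)  (no _)  _ _ = refl
ind-⇔ (yes p) (no ¬q) f _ = contradiction (f p) ¬q
ind-⇔ (no ¬p) (yes q) _ g = contradiction (g q) ¬p

ind-no : ∀ {a} {P : Set a} (P? : Dec P) → ¬ P → ind P? ≡ 0ℤ
ind-no (yes p) ¬p = contradiction p ¬p
ind-no (no _)  _  = refl

ind-yes : ∀ {a} {P : Set a} (P? : Dec P) → P → ind P? ≡ 1ℤ
ind-yes (yes _) _ = refl
ind-yes (no ¬p) p = contradiction p ¬p

-- Sums over tuples and over subsets

sumTuples : ∀ k {n} → (Vec (Fin n) k → ℤ) → ℤ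
sumTuples zero        F = F []
sumTuples (suc k) {n} F = ∑[ i < n ] sumTuples k (F ∘ (i ∷_))

-- Subsets are split by whether they contain `zero`, as in Pascal's rule; each one is presented as
-- its increasing tuple.
sumSubsets : ∀ k {n} → (Vec (Fin n) k → ℤ) → ℤ
sumSubsets zero            F = F []
sumSubsets (suc k) {zero}  F = 0ℤ
sumSubsets (suc k) {suc n} F =
  sumSubsets k (F ∘ (zero ∷_) ∘ Vec.map suc) + sumSubsets (suc k) (F ∘ Vec.map suc)

∑-zero : ∀ {n} {f : Fin n → ℤ} → (∀ i → f i ≡ 0ℤ) → sum f ≡ 0ℤ
∑-zero {n} f≡0 = trans (sum-cong-≗ f≡0) (sum-replicate-zero n)

sumTuples-cong : ∀ k {n} {F G : Vec (Fin n) k → ℤ} → (∀ v → F v ≡ G v) → sumTuples k F ≡ sumTuples k G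
sumTuples-cong zero    F≗G = F≗G []
sumTuples-cong (suc k) F≗G = sum-cong-≗ λ i → sumTuples-cong k (F≗G ∘ (i ∷_))

sumTuples-zero : ∀ k {n} {F : Vec (Fin n) k → ℤ} → (∀ v → F v ≡ 0ℤ) → sumTuples k F ≡ 0ℤ
sumTuples-zero zero    F≗0 = F≗0 []
sumTuples-zero (suc k) F≗0 = ∑-zero λ i → sumTuples-zero k (F≗0 ∘ (i ∷_))

sumSubsets-count : ∀ k n → sumSubsets k {n} (λ _ → 1ℤ) ≡ + (n C k)
sumSubsets-count zero    n       = refl
sumSubsets-count (suc k) zero    = refl
sumSubsets-count (suc k) (suc n) = begin
  sumSubsets k {n} (λ _ → 1ℤ) + sumSubsets (suc k) {n} (λ _ → 1ℤ)
    ≡⟨ cong₂ _+_ (sumSubsets-count k n) (sumSubsets-count (suc k) n) ⟩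
  + (n C k ℕ.+ n C suc k)                                        ≡⟨ cong +_ (nCk+nC[k+1]≡[n+1]C[k+1] n k) ⟩
  + (suc n C suc k)                                              ∎
  where open ≡-Reasoning

sumSubsets-+ : ∀ k {n} (F G : Vec (Fin n) k → ℤ) → sumSubsets k (λ v → F v + G v) ≡ sumSubsets k F + sumSubsets k G
sumSubsets-+ zero            F G = refl
sumSubsets-+ (suc k) {zero}  F G = refl
sumSubsets-+ (suc k) {suc n} F G = trans
  (cong₂ _+_ (sumSubsets-+ k _ _) (sumSubsets-+ (suc k) (F ∘ Vec.map suc) (G ∘ Vec.map suc)))
  (interchange (sumSubsets k (F ∘ (zero ∷_) ∘ Vec.map suc)) (sumSubsets k (G ∘ (zero ∷_) ∘ Vec.map suc)) _ _)
  where
  interchange : ∀ a b c d → (a + b) + (c + d) ≡ (a + c) + (b + d)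
  interchange = solve-∀

sumSubsets-* : ∀ k {n} c (F : Vec (Fin n) k → ℤ) → sumSubsets k (λ v → c * F v) ≡ c * sumSubsets k F
sumSubsets-* zero            c F = refl
sumSubsets-* (suc k) {zero}  c F = sym (*-zeroʳ c)
sumSubsets-* (suc k) {suc n} c F = trans
  (cong₂ _+_ (sumSubsets-* k c _) (sumSubsets-* (suc k) c (F ∘ Vec.map suc))) (sym (*-distribˡ-+ c _ _))

sumTuples-without-zero : ∀ k {n} {F : Vec (Fin (suc n)) k → ℤ} → (∀ v → zero ∈ v → F v ≡ 0ℤ) →
  sumTuples k F ≡ sumTuples k (F ∘ Vec.map suc)
sumTuples-without-zero zero        _   = refl
sumTuples-without-zero (suc k) {n} {F} F≡0 = begin
  sumTuples k (F ∘ (zero ∷_)) + ∑[ i < n ] sumTuples k (F ∘ (suc i ∷_))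
    ≡⟨ cong₂ _+_ (sumTuples-zero k (λ v → F≡0 (zero ∷ v) (here refl))) (sum-cong-≗ λ i → sumTuples-without-zero k (λ v 0∈v → F≡0 (suc i ∷ v) (there 0∈v))) ⟩
  0ℤ + sumTuples (suc k) (F ∘ Vec.map suc)                             ≡⟨ +-identityˡ _ ⟩
  sumTuples (suc k) (F ∘ Vec.map suc)                                  ∎
  where open ≡-Reasoning

-- Adjacent transpositions suffice, since they generate all permutations, and `skip` lets symmetry
-- pass to the function of the remaining entries when a first entry is fixed.
data Swap {A : Set} : ∀ {k} → Vec A k → Vec A k → Set where
  swap : ∀ {k} x y (v : Vec A k) → Swap (x ∷ y ∷ v) (y ∷ x ∷ v)
  skip : ∀ {k} x {v w : Vec A k} → Swap v w → Swap (x ∷ v) (x ∷ w)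

data Repeats {A : Set} : ∀ {k} → Vec A k → Set where
  here  : ∀ {k x} {v : Vec A k} → x ∈ v → Repeats (x ∷ v)
  there : ∀ {k x} {v : Vec A k} → Repeats v → Repeats (x ∷ v)

Symmetric : ∀ {A : Set} {k} → (Vec A k → ℤ) → Set
Symmetric F = ∀ {v w} → Swap v w → F v ≡ F w

-- Vanishing on repetitions without a sign rule: it is paired with `Symmetric`, the situation of the
-- square of an alternating form.
Alternating : ∀ {A : Set} {k} → (Vec A k → ℤ) → Set
Alternating F = ∀ {v} → Repeats v → F v ≡ 0ℤ

swap-map : ∀ {A B : Set} (f : A → B) {k} {v w : Vec A k} → Swap v w → Swap (Vec.map f v) (Vec.map f w)
swap-map f (swap x y v) = swap (f x) (f y) (Vec.map f v)
swap-map f (skip x s)   = skip (f x) (swap-map f s)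

repeats-map : ∀ {A B : Set} (f : A → B) {k} {v : Vec A k} → Repeats v → Repeats (Vec.map f v)
repeats-map f (here x∈v) = here (∈-map⁺ f x∈v)
repeats-map f (there r)  = there (repeats-map f r)

-- A tuple that contributes has `zero` at most once. If it occurs, it stands in one of `suc k`
-- positions, and symmetry makes all of them equivalent to the first.
sumTuples-peel : ∀ k {n} {F : Vec (Fin (suc n)) (suc k) → ℤ} → Symmetric F → Alternating F →
  sumTuples (suc k) F ≡
    + suc k * sumTuples k (F ∘ (zero ∷_) ∘ Vec.map suc) + sumTuples (suc k) (F ∘ Vec.map suc)
sumTuples-peel zero    {n} {F} F-sym F-alt = cong (_+ sumTuples 1 (F ∘ Vec.map suc)) (sym (*-identityˡ (F (zero ∷ []))))
sumTuples-peel (suc k) {n} {F} F-sym F-alt = begin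
  sumTuples (suc k) (F ∘ (zero ∷_)) + ∑[ i < n ] sumTuples (suc k) (F ∘ (suc i ∷_))
    ≡⟨ cong₂ _+_ (sumTuples-without-zero (suc k) λ v 0∈v → F-alt (here 0∈v))
         (sum-cong-≗ λ i → sumTuples-peel k {F = F ∘ (suc i ∷_)} (F-sym ∘ skip (suc i)) (F-alt ∘ there)) ⟩
  T₀ + ∑[ i < n ] (+ suc k * sumTuples k (F ∘ (suc i ∷_) ∘ (zero ∷_) ∘ Vec.map suc) + sumTuples (suc k) (F ∘ (suc i ∷_) ∘ Vec.map suc))
    ≡⟨ cong (_+_ T₀) (∑-distrib-+ {n} _ _) ⟩
  T₀ + (∑[ i < n ] (+ suc k * sumTuples k (F ∘ (suc i ∷_) ∘ (zero ∷_) ∘ Vec.map suc)) + T₁)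
    ≡⟨ cong (λ t → T₀ + (t + T₁)) (*-distribˡ-sum {n} (+ suc k) _) ⟨
  T₀ + (+ suc k * ∑[ i < n ] sumTuples k (F ∘ (suc i ∷_) ∘ (zero ∷_) ∘ Vec.map suc) + T₁)
    -- The induction hypothesis, applied behind the first entry `suc i`, has left `zero` in second
    -- place; one swap brings it to the front.
    ≡⟨ cong (λ t → T₀ + (+ suc k * t + T₁)) (sum-cong-≗ λ i → sumTuples-cong k λ v → F-sym (swap (suc i) zero (Vec.map suc v))) ⟩
  T₀ + (+ suc k * T₀ + T₁)
    ≡⟨ +-assoc T₀ _ T₁ ⟨
  (T₀ + + suc k * T₀) + T₁
    ≡⟨ cong (_+ T₁) (suc-* (+ suc k) T₀) ⟨
  + suc (suc k) * T₀ + T₁ ∎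
  where
  open ≡-Reasoning
  T₀ = sumTuples (suc k) (F ∘ (zero ∷_) ∘ Vec.map suc)
  T₁ = sumTuples (suc (suc k)) (F ∘ Vec.map suc)

-- Each subset has k! orderings; the factors `suc k` of `sumTuples-peel` multiply up to the
-- factorial.
sumTuples-subsets : ∀ k {n} {F : Vec (Fin n) k → ℤ} → Symmetric F → Alternating F →
  sumTuples k F ≡ + (k !) * sumSubsets k F
sumTuples-subsets zero            {F = F} F-sym F-alt = sym (*-identityˡ (F []))
sumTuples-subsets (suc k) {zero}  F-sym F-alt = sym (*-zeroʳ (+ (suc k !)))
sumTuples-subsets (suc k) {suc n} {F} F-sym F-alt = begin
  sumTuples (suc k) F
    ≡⟨ sumTuples-peel k F-sym F-alt ⟩
  + suc k * sumTuples k (F ∘ (zero ∷_) ∘ Vec.map suc) + sumTuples (suc k) (F ∘ Vec.map suc)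
    ≡⟨ cong₂ (λ t u → + suc k * t + u)
         (sumTuples-subsets k (F-sym ∘ skip zero ∘ swap-map suc) (F-alt ∘ there ∘ repeats-map suc))
         (sumTuples-subsets (suc k) (F-sym ∘ swap-map suc) (F-alt ∘ repeats-map suc)) ⟩
  + suc k * (+ (k !) * S₀) + + (suc k !) * S₁
    ≡⟨ cong (_+ + (suc k !) * S₁) (trans (sym (*-assoc (+ suc k) (+ (k !)) S₀)) (cong (_* S₀) (sym (pos-* (suc k) (k !))))) ⟩
  + (suc k !) * S₀ + + (suc k !) * S₁
    ≡⟨ *-distribˡ-+ (+ (suc k !)) S₀ S₁ ⟨
  + (suc k !) * (S₀ + S₁) ∎
  where
  open ≡-Reasoning
  S₀ = sumSubsets k (F ∘ (zero ∷_) ∘ Vec.map suc)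
  S₁ = sumSubsets (suc k) (F ∘ Vec.map suc)

-- From the lists that define `numEdges` to sums over subsets

sumList : {A : Set} → (A → ℤ) → List A → ℤ
sumList F = List.foldr (λ x t → F x + t) 0ℤ

sumList-++ : {A : Set} (F : A → ℤ) → ∀ xs ys → sumList F (xs List.++ ys) ≡ sumList F xs + sumList F ys
sumList-++ F []       ys = sym (+-identityˡ _)
sumList-++ F (x ∷ xs) ys = trans (cong (_+_ (F x)) (sumList-++ F xs ys)) (sym (+-assoc (F x) _ _))

sumList-map : {A B : Set} (F : B → ℤ) (h : A → B) → ∀ xs → sumList F (List.map h xs) ≡ sumList (F ∘ h) xs
sumList-map F h []       = refl
sumList-map F h (x ∷ xs) = cong (_+_ (F (h x))) (sumList-map F h xs)

sumList-concatMap-tabulate : ∀ {A B : Set} {n} (F : B → ℤ) (h : A → List B) (t : Fin n → A) →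
  sumList F (concatMap h (List.tabulate t)) ≡ ∑[ i < n ] sumList F (h (t i))
sumList-concatMap-tabulate {n = zero}  F h t = refl
sumList-concatMap-tabulate {n = suc n} F h t = trans
  (sumList-++ F (h (t zero)) _) (cong (_+_ (sumList F (h (t zero)))) (sumList-concatMap-tabulate F h (t ∘ suc)))

sumList-tuples : ∀ k {n} (F : Vec (Fin n) k → ℤ) → sumList F (tuples k n) ≡ sumTuples k F
sumList-tuples zero    F = +-identityʳ (F [])
sumList-tuples (suc k) {n} F = trans
  (sumList-concatMap-tabulate F (λ i → List.map (i ∷_) (tuples k n)) id)
  (sum-cong-≗ λ i → trans (sumList-map F (i ∷_) (tuples k n)) (sumList-tuples k (F ∘ (i ∷_))))

-- `filter` and `ind` both branch on `does`, so abstracting `does (Q? x)` and `does (P? x)` reduces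
-- the two sides together.
length-filter-filter : {A : Set} {P Q : A → Set} (P? : ∀ x → Dec (P x)) (Q? : ∀ x → Dec (Q x)) → ∀ xs →
  + length (filter P? (filter Q? xs)) ≡ sumList (λ x → ind (Q? x) * ind (P? x)) xs
length-filter-filter P? Q? [] = refl
length-filter-filter P? Q? (x ∷ xs) with does (Q? x)
... | false = trans (length-filter-filter P? Q? xs) (sym (+-identityˡ _))
... | true with does (P? x)
...   | false = trans (length-filter-filter P? Q? xs) (sym (+-identityˡ _))
...   | true  = cong (_+_ 1ℤ) (length-filter-filter P? Q? xs)

isSet-map-suc : ∀ {k n} (v : Vec (Fin n) k) → IsSet v → IsSet (Vec.map suc v)
isSet-map-suc []          s          = []
isSet-map-suc (x ∷ [])    s          = [-]
isSet-map-suc (x ∷ y ∷ v) (x<y ∷ s)  = ℕ.s≤s x<y ∷ isSet-map-suc (y ∷ v) s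

isSet-map-suc⁻ : ∀ {k n} (v : Vec (Fin n) k) → IsSet (Vec.map suc v) → IsSet v
isSet-map-suc⁻ []          s                = []
isSet-map-suc⁻ (x ∷ [])    s                = [-]
isSet-map-suc⁻ (x ∷ y ∷ v) (ℕ.s≤s x<y ∷ s)  = x<y ∷ isSet-map-suc⁻ (y ∷ v) s

isSet-tail : ∀ {k n} {x : Fin n} (v : Vec (Fin n) k) → IsSet (x ∷ v) → IsSet v
isSet-tail []      _       = []
isSet-tail (y ∷ v) (_ ∷ s) = s

isSet-zero∷map-suc : ∀ {k n} (v : Vec (Fin n) k) → IsSet v → IsSet (zero ∷ Vec.map suc v)
isSet-zero∷map-suc []      s = [-]
isSet-zero∷map-suc (x ∷ v) s = ℕ.s≤s ℕ.z≤n ∷ isSet-map-suc (x ∷ v) s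

zero∉tail : ∀ {k n} {x : Fin (suc n)} (v : Vec (Fin (suc n)) k) → IsSet (x ∷ v) → ¬ zero ∈ v
zero∉tail (y ∷ v) (() ∷ _) (here refl)
zero∉tail (y ∷ v) (_ ∷ s)  (there 0∈v) = zero∉tail v s 0∈v

-- In an increasing tuple `zero` can only stand first, so splitting by the first entry is the same
-- as the split in `sumSubsets` by membership of `zero`.
sumTuples-isSet : ∀ k {n} (F : Vec (Fin n) k → ℤ) → sumTuples k (λ v → ind (isSet? v) * F v) ≡ sumSubsets k F
sumTuples-isSet zero            F = *-identityˡ (F [])
sumTuples-isSet (suc k) {zero}  F = refl
sumTuples-isSet (suc k) {suc n} F = cong₂ _+_
  (begin
    sumTuples k (G ∘ (zero ∷_))
      ≡⟨ sumTuples-without-zero k (λ v → vanish zero v) ⟩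
    sumTuples k (G ∘ (zero ∷_) ∘ Vec.map suc)
      ≡⟨ sumTuples-cong k (λ v → cong (_* F (zero ∷ Vec.map suc v)) (ind-⇔ (isSet? (zero ∷ Vec.map suc v)) (isSet? v)
           (isSet-map-suc⁻ v ∘ isSet-tail (Vec.map suc v)) (isSet-zero∷map-suc v))) ⟩
    sumTuples k (λ v → ind (isSet? v) * F (zero ∷ Vec.map suc v))
      ≡⟨ sumTuples-isSet k (F ∘ (zero ∷_) ∘ Vec.map suc) ⟩
    sumSubsets k (F ∘ (zero ∷_) ∘ Vec.map suc) ∎)
  (begin
    ∑[ i < n ] sumTuples k (G ∘ (suc i ∷_))
      ≡⟨ sum-cong-≗ (λ i → sumTuples-without-zero k (vanish (suc i))) ⟩
    sumTuples (suc k) (G ∘ Vec.map suc)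
      ≡⟨ sumTuples-cong (suc k) (λ v → cong (_* F (Vec.map suc v)) (ind-⇔ (isSet? (Vec.map suc v)) (isSet? v) (isSet-map-suc⁻ v) (isSet-map-suc v))) ⟩
    sumTuples (suc k) (λ v → ind (isSet? v) * F (Vec.map suc v))
      ≡⟨ sumTuples-isSet (suc k) (F ∘ Vec.map suc) ⟩
    sumSubsets (suc k) (F ∘ Vec.map suc) ∎)
  where
  open ≡-Reasoning
  G : Vec (Fin (suc n)) (suc k) → ℤ
  G v = ind (isSet? v) * F v
  vanish : ∀ x v → zero ∈ v → G (x ∷ v) ≡ 0ℤ
  vanish x v 0∈v = cong (_* F (x ∷ v)) (ind-no (isSet? (x ∷ v)) (λ s → zero∉tail v s 0∈v))

length-filter-kSets : ∀ k n {P : Vec (Fin n) k → Set} (P? : ∀ v → Dec (P v)) →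
  + length (filter P? (kSets k n)) ≡ sumSubsets k (ind ∘ P?)
length-filter-kSets k n P? = trans (length-filter-filter P? isSet? (tuples k n))
  (trans (sumList-tuples k _) (sumTuples-isSet k (ind ∘ P?)))

sumSubsets-cong : ∀ k {n} {F G : Vec (Fin n) k → ℤ} → (∀ v → IsSet v → F v ≡ G v) → sumSubsets k F ≡ sumSubsets k G
sumSubsets-cong zero            F≗G = F≗G [] []
sumSubsets-cong (suc k) {zero}  F≗G = refl
sumSubsets-cong (suc k) {suc n} F≗G = cong₂ _+_
  (sumSubsets-cong k (λ v s → F≗G (zero ∷ Vec.map suc v) (isSet-zero∷map-suc v s)))
  (sumSubsets-cong (suc k) (λ v s → F≗G (Vec.map suc v) (isSet-map-suc v s)))

-- Meant for F a squared Pfaffian and c = 8 = 3² - 1²: it turns the sum of squared Pfaffians into an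
-- affine function of the number of edges.
sumSubsets-indicator : ∀ k n {P : Vec (Fin n) k → Set} (P? : ∀ v → Dec (P v)) c {F : Vec (Fin n) k → ℤ} →
  (∀ v → IsSet v → 1ℤ + c * ind (P? v) ≡ F v) →
  sumSubsets k F ≡ + (n C k) + c * + length (filter P? (kSets k n))
sumSubsets-indicator k n P? c {F} F≗ = begin
  sumSubsets k F
    ≡⟨ sumSubsets-cong k (λ v s → sym (F≗ v s)) ⟩
  sumSubsets k (λ v → 1ℤ + c * ind (P? v))
    ≡⟨ sumSubsets-+ k (λ _ → 1ℤ) (λ v → c * ind (P? v)) ⟩
  sumSubsets k {n} (λ _ → 1ℤ) + sumSubsets k (λ v → c * ind (P? v))
    ≡⟨ cong₂ _+_ (sumSubsets-count k n) (sumSubsets-* k c (ind ∘ P?)) ⟩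
  + (n C k) + c * sumSubsets k (ind ∘ P?)
    ≡⟨ cong (λ t → + (n C k) + c * t) (length-filter-kSets k n P?) ⟨
  + (n C k) + c * + length (filter P? (kSets k n))                ∎
  where open ≡-Reasoning

-- Integer sums, and binomial coefficients as polynomials

∑-const : ∀ n c → ∑[ i < n ] c ≡ + n * c
∑-const zero    c = refl
∑-const (suc n) c = trans (cong (_+_ c) (∑-const n c)) (sym (suc-* (+ n) c))

∑-nonneg : ∀ {n} {f : Fin n → ℤ} → (∀ i → 0ℤ ≤ f i) → 0ℤ ≤ sum f
∑-nonneg {zero}  0≤f = ≤-refl
∑-nonneg {suc n} 0≤f = +-mono-≤ (0≤f zero) (∑-nonneg (0≤f ∘ suc))

i+j≡0⇒i≡0 : ∀ {i j} → 0ℤ ≤ i → 0ℤ ≤ j → i + j ≡ 0ℤ → i ≡ 0ℤ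
i+j≡0⇒i≡0 {i} {j} 0≤i 0≤j i+j≡0 = ≤-antisym (begin
  i       ≡⟨ +-identityʳ i ⟨
  i + 0ℤ  ≤⟨ +-monoʳ-≤ i 0≤j ⟩
  i + j   ≡⟨ i+j≡0 ⟩
  0ℤ      ∎) 0≤i
  where open ≤-Reasoning

∑-nonneg-zero : ∀ {n} {f : Fin n → ℤ} → (∀ i → 0ℤ ≤ f i) → sum f ≡ 0ℤ → ∀ i → f i ≡ 0ℤ
∑-nonneg-zero {suc n} {f} 0≤f ∑≡0 zero    = i+j≡0⇒i≡0 (0≤f zero) (∑-nonneg (0≤f ∘ suc)) ∑≡0
∑-nonneg-zero {suc n} {f} 0≤f ∑≡0 (suc i) = ∑-nonneg-zero (0≤f ∘ suc)
  (i+j≡0⇒i≡0 (∑-nonneg (0≤f ∘ suc)) (0≤f zero) (trans (+-comm _ (f zero)) ∑≡0)) i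

0≤i*i : ∀ i → 0ℤ ≤ i * i
0≤i*i (+ n)    = subst (0ℤ ≤_) (pos-* n n) (+≤+ ℕ.z≤n)
0≤i*i -[1+ n ] = +≤+ ℕ.z≤n

i*i≡0⇒i≡0 : ∀ i → i * i ≡ 0ℤ → i ≡ 0ℤ
i*i≡0⇒i≡0 i i*i≡0 with i*j≡0⇒i≡0∨j≡0 i i*i≡0
... | inj₁ i≡0 = i≡0
... | inj₂ i≡0 = i≡0

∑-product : ∀ {m n} (f : Fin m → ℤ) (g : Fin n → ℤ) → ∑[ i < m ] ∑[ j < n ] (f i * g j) ≡ sum f * sum g
∑-product f g = trans (sum-cong-≗ λ i → sym (*-distribˡ-sum (f i) g)) (sym (*-distribʳ-sum (sum g) f))

-- Here and in the next two lemmas denominators are cleared and subtraction is that of ℤ, which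
-- makes the right side a polynomial for the ring solver. Small n is no exception, because then one
-- of the factors is zero.
2*nC2 : ∀ n → + 2 * + (n C 2) ≡ + n * (+ n - + 1)
2*nC2 zero    = refl
2*nC2 (suc n) = begin
  + 2 * + (suc n C 2)               ≡⟨ cong (λ t → + 2 * + t) (nCk+nC[k+1]≡[n+1]C[k+1] n 1) ⟨
  + 2 * (+ (n C 1) + + (n C 2))     ≡⟨ *-distribˡ-+ (+ 2) (+ (n C 1)) (+ (n C 2)) ⟩
  + 2 * + (n C 1) + + 2 * + (n C 2) ≡⟨ cong₂ (λ t u → + 2 * + t + u) (nC1≡n n) (2*nC2 n) ⟩
  + 2 * + n + + n * (+ n - + 1)     ≡⟨ ring (+ n) ⟩
  (+ 1 + + n) * (+ 1 + + n - + 1)   ∎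
  where
  open ≡-Reasoning
  ring : ∀ n → + 2 * n + n * (n - + 1) ≡ (+ 1 + n) * (+ 1 + n - + 1)
  ring = solve-∀

6*nC3 : ∀ n → + 6 * + (n C 3) ≡ + n * (+ n - + 1) * (+ n - + 2)
6*nC3 zero    = refl
6*nC3 (suc n) = begin
  + 6 * + (suc n C 3)                  ≡⟨ cong (λ t → + 6 * + t) (nCk+nC[k+1]≡[n+1]C[k+1] n 2) ⟨
  + 6 * (+ (n C 2) + + (n C 3))        ≡⟨ split (+ (n C 2)) (+ (n C 3)) ⟩
  + 3 * (+ 2 * + (n C 2)) + + 6 * + (n C 3)  ≡⟨ cong₂ (λ t u → + 3 * t + u) (2*nC2 n) (6*nC3 n) ⟩
  + 3 * (+ n * (+ n - + 1)) + + n * (+ n - + 1) * (+ n - + 2)  ≡⟨ ring (+ n) ⟩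
  (+ 1 + + n) * (+ 1 + + n - + 1) * (+ 1 + + n - + 2)  ∎
  where
  open ≡-Reasoning
  split : ∀ x y → + 6 * (x + y) ≡ + 3 * (+ 2 * x) + + 6 * y
  split = solve-∀
  ring : ∀ n → + 3 * (n * (n - + 1)) + n * (n - + 1) * (n - + 2) ≡ (+ 1 + n) * (+ 1 + n - + 1) * (+ 1 + n - + 2)
  ring = solve-∀

24*nC4 : ∀ n → + 24 * + (n C 4) ≡ + n * (+ n - + 1) * (+ n - + 2) * (+ n - + 3)
24*nC4 zero    = refl
24*nC4 (suc n) = begin
  + 24 * + (suc n C 4)                  ≡⟨ cong (λ t → + 24 * + t) (nCk+nC[k+1]≡[n+1]C[k+1] n 3) ⟨
  + 24 * (+ (n C 3) + + (n C 4))        ≡⟨ split (+ (n C 3)) (+ (n C 4)) ⟩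
  + 4 * (+ 6 * + (n C 3)) + + 24 * + (n C 4)  ≡⟨ cong₂ (λ t u → + 4 * t + u) (6*nC3 n) (24*nC4 n) ⟩
  + 4 * (+ n * (+ n - + 1) * (+ n - + 2)) + + n * (+ n - + 1) * (+ n - + 2) * (+ n - + 3)  ≡⟨ ring (+ n) ⟩
  (+ 1 + + n) * (+ 1 + + n - + 1) * (+ 1 + + n - + 2) * (+ 1 + + n - + 3)  ∎
  where
  open ≡-Reasoning
  split : ∀ x y → + 24 * (x + y) ≡ + 4 * (+ 6 * x) + + 24 * y
  split = solve-∀
  ring : ∀ n → + 4 * (n * (n - + 1) * (n - + 2)) + n * (n - + 1) * (n - + 2) * (n - + 3) ≡
               (+ 1 + n) * (+ 1 + n - + 1) * (+ 1 + n - + 2) * (+ 1 + n - + 3)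
  ring = solve-∀

-- Skew matrices of signs

-- What `sumTuples 4` unfolds to, in curried form, so that the four variables can be renamed
-- separately.
∑₄ : ∀ {n} → (Fin n → Fin n → Fin n → Fin n → ℤ) → ℤ
∑₄ {n} F = ∑[ a < n ] ∑[ b < n ] ∑[ c < n ] ∑[ d < n ] F a b c d

∑₄-cong : ∀ {n} {F G : Fin n → Fin n → Fin n → Fin n → ℤ} → (∀ a b c d → F a b c d ≡ G a b c d) → ∑₄ F ≡ ∑₄ G
∑₄-cong F≗G = sum-cong-≗ λ a → sum-cong-≗ λ b → sum-cong-≗ λ c → sum-cong-≗ λ d → F≗G a b c d

∑₄-+ : ∀ {n} (F G : Fin n → Fin n → Fin n → Fin n → ℤ) → ∑₄ (λ a b c d → F a b c d + G a b c d) ≡ ∑₄ F + ∑₄ G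
∑₄-+ {n} F G =
  trans (sum-cong-≗ λ a → trans (sum-cong-≗ λ b → trans (sum-cong-≗ λ c →
    ∑-distrib-+ (F a b c) (G a b c)) (∑-distrib-+ {n} _ _)) (∑-distrib-+ {n} _ _)) (∑-distrib-+ {n} _ _)

∑₄-* : ∀ {n} k (F : Fin n → Fin n → Fin n → Fin n → ℤ) → ∑₄ (λ a b c d → k * F a b c d) ≡ k * ∑₄ F
∑₄-* {n} k F = sym
  (trans (*-distribˡ-sum {n} k _) (sum-cong-≗ λ a → trans (*-distribˡ-sum {n} k _) (sum-cong-≗ λ b →
    trans (*-distribˡ-sum {n} k _) (sum-cong-≗ λ c → *-distribˡ-sum k (F a b c)))))

∑₄-swap₂₃ : ∀ {n} (F : Fin n → Fin n → Fin n → Fin n → ℤ) → ∑₄ (λ a b c d → F a c b d) ≡ ∑₄ F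
∑₄-swap₂₃ {n} F = sum-cong-≗ λ a → ∑-comm {n} {n} (λ b c → ∑[ d < n ] F a c b d)

∑₄-swap₃₄ : ∀ {n} (F : Fin n → Fin n → Fin n → Fin n → ℤ) → ∑₄ (λ a b c d → F a b d c) ≡ ∑₄ F
∑₄-swap₃₄ {n} F = sum-cong-≗ λ a → sum-cong-≗ λ b → ∑-comm {n} {n} (λ c d → F a b d c)

-- One term for each perfect matching of the four points. For a skew matrix the square is the
-- determinant; for entries ±1 it is a sum of three signs, hence ±1 or ±3.
pfaffian : ∀ {A : Set} → (A → A → ℤ) → A → A → A → A → ℤ
pfaffian s a b c d = s a b * s c d - s a c * s b d + s a d * s b c

pfaffian² : ∀ {A : Set} → (A → A → ℤ) → Vec A 4 → ℤ
pfaffian² s (a ∷ b ∷ c ∷ d ∷ []) = pfaffian s a b c d * pfaffian s a b c d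

record IsSkewSign {n} (s : Fin n → Fin n → ℤ) : Set where
  field
    skew : ∀ i j → s i j ≡ - s j i
    diag : ∀ i → s i i ≡ 0ℤ
    unit : ∀ {i j} → i ≢ j → s i j * s i j ≡ 1ℤ

module _ {m} {s : Fin (suc m) → Fin (suc m) → ℤ} (s-sign : IsSkewSign s) where
  open IsSkewSign s-sign

  private
    n = suc m

  -- An adjacent swap negates the Pfaffian. Only the entry between the two swapped points gets
  -- reversed, hence a single rewrite by `skew` in each case.
  pfaffian²-symmetric : Symmetric (pfaffian² s)
  pfaffian²-symmetric (swap a b (c ∷ d ∷ [])) rewrite skew b a = ring (s a b) (s a c) (s a d) (s b c) (s b d) (s c d)
    where
    ring : ∀ ab ac ad bc bd cd →
      (ab * cd - ac * bd + ad * bc) * (ab * cd - ac * bd + ad * bc) ≡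
      (- ab * cd - bc * ad + bd * ac) * (- ab * cd - bc * ad + bd * ac)
    ring = solve-∀
  pfaffian²-symmetric (skip a (swap b c (d ∷ []))) rewrite skew c b = ring (s a b) (s a c) (s a d) (s b c) (s b d) (s c d)
    where
    ring : ∀ ab ac ad bc bd cd →
      (ab * cd - ac * bd + ad * bc) * (ab * cd - ac * bd + ad * bc) ≡
      (ac * bd - ab * cd + ad * - bc) * (ac * bd - ab * cd + ad * - bc)
    ring = solve-∀
  pfaffian²-symmetric (skip a (skip b (swap c d []))) rewrite skew d c = ring (s a b) (s a c) (s a d) (s b c) (s b d) (s c d)
    where
    ring : ∀ ab ac ad bc bd cd →
      (ab * cd - ac * bd + ad * bc) * (ab * cd - ac * bd + ad * bc) ≡
      (ab * - cd - ad * bc + ac * bd) * (ab * - cd - ad * bc + ac * bd)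
    ring = solve-∀

  pfaffian²-symmetric (skip _ (skip _ (skip _ (skip _ ()))))

  pfaffian²-alternating : Alternating (pfaffian² s)
  pfaffian²-alternating {a ∷ _ ∷ c ∷ d ∷ []} (here (here refl)) rewrite diag a = ring (s a c) (s a d) (s c d)
    where
    ring : ∀ ac ad cd → (0ℤ * cd - ac * ad + ad * ac) * (0ℤ * cd - ac * ad + ad * ac) ≡ 0ℤ
    ring = solve-∀
  pfaffian²-alternating {a ∷ b ∷ _ ∷ d ∷ []} (here (there (here refl))) rewrite diag a | skew b a = ring (s a b) (s a d) (s b d)
    where
    ring : ∀ ab ad bd → (ab * ad - 0ℤ * bd + ad * - ab) * (ab * ad - 0ℤ * bd + ad * - ab) ≡ 0ℤ
    ring = solve-∀
  pfaffian²-alternating {a ∷ b ∷ c ∷ _ ∷ []} (here (there (there (here refl)))) rewrite diag a | skew b a | skew c a = ring (s a b) (s a c) (s b c)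
    where
    ring : ∀ ab ac bc → (ab * - ac - ac * - ab + 0ℤ * bc) * (ab * - ac - ac * - ab + 0ℤ * bc) ≡ 0ℤ
    ring = solve-∀
  pfaffian²-alternating {a ∷ b ∷ _ ∷ d ∷ []} (there (here (here refl))) rewrite diag b = ring (s a b) (s a d) (s b d)
    where
    ring : ∀ ab ad bd → (ab * bd - ab * bd + ad * 0ℤ) * (ab * bd - ab * bd + ad * 0ℤ) ≡ 0ℤ
    ring = solve-∀
  pfaffian²-alternating {a ∷ b ∷ c ∷ _ ∷ []} (there (here (there (here refl)))) rewrite diag b | skew c b = ring (s a b) (s a c) (s b c)
    where
    ring : ∀ ab ac bc → (ab * - bc - ac * 0ℤ + ab * bc) * (ab * - bc - ac * 0ℤ + ab * bc) ≡ 0ℤ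
    ring = solve-∀
  pfaffian²-alternating {a ∷ b ∷ c ∷ _ ∷ []} (there (there (here (here refl)))) rewrite diag c = ring (s a b) (s a c) (s b c)
    where
    ring : ∀ ab ac bc → (ab * 0ℤ - ac * bc + ac * bc) * (ab * 0ℤ - ac * bc + ac * bc) ≡ 0ℤ
    ring = solve-∀
  pfaffian²-alternating (there (there (there (here ()))))
  pfaffian²-alternating (there (there (there (there ()))))

  S² : Fin n → Fin n → ℤ
  S² a c = ∑[ b < n ] (s a b * s b c)

  private
    -- The two kinds of monomials in a squared Pfaffian. Summed over all quadruples, `square` gives
    -- the square of the sum of all squared entries, and `cycle`, a closed walk of length 4, gives
    -- tr S⁴.
    square cycle : Fin n → Fin n → Fin n → Fin n → ℤ
    square a b c d = (s a b * s a b) * (s c d * s c d)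
    cycle  a b c d = (s a b * s b c) * (s c d * s d a)

    row : ∀ a → ∑[ b < n ] (s a b * s a b) ≡ + m
    row a = begin
      ∑[ b < n ] (s a b * s a b)
        ≡⟨ sum-remove {i = a} (λ b → s a b * s a b) ⟩
      s a a * s a a + ∑[ j < m ] (s a (punchIn a j) * s a (punchIn a j))
        ≡⟨ cong₂ _+_ (cong (λ t → t * t) (diag a)) (sum-cong-≗ λ j → unit (≢-sym (punchInᵢ≢i a j))) ⟩
      0ℤ + ∑[ j < m ] 1ℤ
        ≡⟨ +-identityˡ (∑[ j < m ] 1ℤ) ⟩
      ∑[ j < m ] 1ℤ
        ≡⟨ ∑-const m 1ℤ ⟩
      + m * 1ℤ
        ≡⟨ *-identityʳ (+ m) ⟩
      + m ∎
      where open ≡-Reasoning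

    ∑-square : ∑₄ square ≡ (+ n * + m) * (+ n * + m)
    ∑-square = begin
      ∑₄ square
        ≡⟨ sum-cong-≗ (λ a → sum-cong-≗ λ b → trans
             (sum-cong-≗ λ c → trans (sym (*-distribˡ-sum {n} (s a b * s a b) (λ d → s c d * s c d))) (cong (_*_ (s a b * s a b)) (row c)))
             (trans (∑-const n (s a b * s a b * + m)) (rearrange (s a b * s a b) (+ n) (+ m)))) ⟩
      ∑[ a < n ] ∑[ b < n ] ((+ n * + m) * (s a b * s a b))
        ≡⟨ sum-cong-≗ (λ a → trans (sym (*-distribˡ-sum {n} (+ n * + m) (λ b → s a b * s a b))) (cong (_*_ (+ n * + m)) (row a))) ⟩
      ∑[ a < n ] ((+ n * + m) * + m)
        ≡⟨ ∑-const n ((+ n * + m) * + m) ⟩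
      + n * ((+ n * + m) * + m)
        ≡⟨ rearrange′ (+ n) (+ m) ⟩
      (+ n * + m) * (+ n * + m) ∎
      where
      open ≡-Reasoning
      rearrange : ∀ x n m → n * (x * m) ≡ (n * m) * x
      rearrange = solve-∀
      rearrange′ : ∀ n m → n * ((n * m) * m) ≡ (n * m) * (n * m)
      rearrange′ = solve-∀

    S²-sym : ∀ a c → S² c a ≡ S² a c
    S²-sym a c = sum-cong-≗ λ b → trans (cong₂ _*_ (skew c b) (skew b a)) (ring (s b c) (s a b))
      where
      ring : ∀ x y → - x * - y ≡ y * x
      ring = solve-∀

  S²-diag : ∀ a → S² a a ≡ - + m
  S²-diag a = begin
    ∑[ b < n ] (s a b * s b a)
      ≡⟨ sum-cong-≗ (λ b → trans (cong (_*_ (s a b)) (skew b a)) (ring (s a b))) ⟩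
    ∑[ b < n ] (-1ℤ * (s a b * s a b))    ≡⟨ *-distribˡ-sum {n} -1ℤ (λ b → s a b * s a b) ⟨
    -1ℤ * ∑[ b < n ] (s a b * s a b)      ≡⟨ cong (_*_ -1ℤ) (row a) ⟩
    -1ℤ * + m                             ≡⟨ -1*i≡-i (+ m) ⟩
    - + m                                 ∎
    where
    open ≡-Reasoning
    ring : ∀ x → x * - x ≡ -1ℤ * (x * x)
    ring = solve-∀

  private
    -- The part of ‖S²‖² in row a off the diagonal; `punchIn a` runs through the columns different
    -- from a.
    off : Fin n → ℤ
    off a = ∑[ j < m ] (S² a (punchIn a j) * S² a (punchIn a j))

    -- With the opposite corners a and c of the walk fixed, the sums over b and d separate into
    -- S²(a,c) S²(c,a), a square because S² is symmetric. The diagonal entries -m supply the first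
    -- summand.
    ∑-cycle : ∑₄ cycle ≡ + n * (+ m * + m) + sum off
    ∑-cycle = begin
      ∑₄ cycle
        ≡⟨ ∑₄-swap₂₃ cycle ⟨
      ∑[ a < n ] ∑[ c < n ] ∑[ b < n ] ∑[ d < n ] ((s a b * s b c) * (s c d * s d a))
        ≡⟨ sum-cong-≗ (λ a → sum-cong-≗ λ c → trans (∑-product (λ b → s a b * s b c) (λ d → s c d * s d a)) (cong (_*_ (S² a c)) (S²-sym a c))) ⟩
      ∑[ a < n ] ∑[ c < n ] (S² a c * S² a c)
        ≡⟨ sum-cong-≗ (λ a → trans (sum-remove {i = a} (λ c → S² a c * S² a c)) (cong (_+ off a) (trans (cong (λ t → t * t) (S²-diag a)) (ring (+ m))))) ⟩
      ∑[ a < n ] (+ m * + m + off a)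
        ≡⟨ ∑-distrib-+ {n} (λ _ → + m * + m) off ⟩
      ∑[ a < n ] (+ m * + m) + sum off
        ≡⟨ cong (_+ sum off) (∑-const n (+ m * + m)) ⟩
      + n * (+ m * + m) + sum off ∎
      where
      open ≡-Reasoning
      ring : ∀ x → - x * - x ≡ x * x
      ring = solve-∀

  -- The union of two different matchings of four points is a 4-cycle. Oriented along that cycle,
  -- each of the three cross terms becomes -2 times a `cycle`, whatever its sign in the Pfaffian
  -- was, and renaming variables identifies the three sums.
  ∑-pfaffian² : sumTuples 4 (pfaffian² s) ≡ + 3 * ((+ n * + m) * (+ n * + m)) - + 6 * ∑₄ cycle
  ∑-pfaffian² = begin
    ∑₄ (λ a b c d → pfaffian s a b c d * pfaffian s a b c d)
      ≡⟨ ∑₄-cong expand ⟩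
    ∑₄ (λ a b c d → (square a b c d + (square a c b d + square a d b c)) + - + 2 * (cycle a b d c + (cycle a b c d + cycle a c b d)))
      ≡⟨ ∑₄-+ (λ a b c d → square a b c d + (square a c b d + square a d b c)) (λ a b c d → - + 2 * (cycle a b d c + (cycle a b c d + cycle a c b d))) ⟩
    ∑₄ (λ a b c d → square a b c d + (square a c b d + square a d b c)) + ∑₄ (λ a b c d → - + 2 * (cycle a b d c + (cycle a b c d + cycle a c b d)))
      ≡⟨ cong₂ _+_
           (trans (∑₄-+ square (λ a b c d → square a c b d + square a d b c)) (cong (_+_ Q) (trans (∑₄-+ square₂₃ (λ a b c d → square a d b c))
             (cong₂ _+_ (∑₄-swap₂₃ square) (trans (∑₄-swap₃₄ square₂₃) (∑₄-swap₂₃ square))))))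
           (trans (∑₄-* (- + 2) (λ a b c d → cycle a b d c + (cycle a b c d + cycle a c b d))) (cong (_*_ (- + 2)) (trans (∑₄-+ (λ a b c d → cycle a b d c) (λ a b c d → cycle a b c d + cycle a c b d))
             (cong₂ _+_ (∑₄-swap₃₄ cycle) (trans (∑₄-+ cycle (λ a b c d → cycle a c b d)) (cong (_+_ T) (∑₄-swap₂₃ cycle))))))) ⟩
    (Q + (Q + Q)) + - + 2 * (T + (T + T))
      ≡⟨ collect Q T ⟩
    + 3 * Q - + 6 * T
      ≡⟨ cong (λ t → + 3 * t - + 6 * T) ∑-square ⟩
    + 3 * ((+ n * + m) * (+ n * + m)) - + 6 * T ∎
    where
    open ≡-Reasoning
    Q = ∑₄ square
    T = ∑₄ cycle
    square₂₃ : Fin n → Fin n → Fin n → Fin n → ℤ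
    square₂₃ a b c d = square a c b d
    collect : ∀ q t → (q + (q + q)) + - + 2 * (t + (t + t)) ≡ + 3 * q - + 6 * t
    collect = solve-∀
    ring : ∀ ab ac ad bc bd cd →
      (ab * cd - ac * bd + ad * bc) * (ab * cd - ac * bd + ad * bc) ≡
      ((ab * ab) * (cd * cd) + ((ac * ac) * (bd * bd) + (ad * ad) * (bc * bc))) +
      - + 2 * ((ab * bd) * (- cd * - ac) + ((ab * bc) * (cd * - ad) + (ac * - bc) * (bd * - ad)))
    ring = solve-∀
    expand : ∀ a b c d → pfaffian s a b c d * pfaffian s a b c d ≡
      (square a b c d + (square a c b d + square a d b c)) + - + 2 * (cycle a b d c + (cycle a b c d + cycle a c b d))
    expand a b c d rewrite skew d c | skew c a | skew d a | skew c b = ring (s a b) (s a c) (s a d) (s b c) (s b d) (s c d)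

  -- In the resulting equation 24 (C(n,4) + 8E) = 3(nm)² - 6(nm² + O) the sum of squares O lowers E.
  -- So n/16 · C(n,3) is an upper bound for E, and attaining it forces O = 0.
  S²-off-diagonal : ∀ E → sumSubsets 4 (pfaffian² s) ≡ + (n C 4) + + 8 * E → + 16 * E ≡ + n * + (n C 3) →
    ∀ {a c} → a ≢ c → S² a c ≡ 0ℤ
  S²-off-diagonal E pf-count E-max {a} {c} a≢c = i*i≡0⇒i≡0 (S² a c)
    -- Nonnegativity is used twice: first every row sum vanishes, then every square in row a;
    -- `punchOut a≢c` is the position of c among the other columns.
    (subst (λ i → S² a i * S² a i ≡ 0ℤ) (punchIn-punchOut a≢c) (∑-nonneg-zero (λ j → 0≤i*i (S² a (punchIn a j)))
      (∑-nonneg-zero (λ i → ∑-nonneg λ j → 0≤i*i (S² i (punchIn i j))) sum-off a) (punchOut a≢c)))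
    where
    open ≡-Reasoning
    N = + n
    O = sum off
    -- `+ suc m` computes to `1ℤ + + m`, so identities in m alone apply directly to N.
    solve-for-off : ∀ m o → let n = 1ℤ + m in
      + 6 * o ≡ + 3 * ((n * m) * (n * m)) - + 6 * (n * (m * m)) - (+ 3 * ((n * m) * (n * m)) - + 6 * (n * (m * m) + o))
    solve-for-off = solve-∀
    -- The value n/16 · C(n,3) enters here: 24 · 8E = 12 · 16E = 2n · 6 C(n,3), and with this term
    -- the polynomial is identically zero.
    cancel : ∀ m → let n = 1ℤ + m in
      + 3 * ((n * m) * (n * m)) - + 6 * (n * (m * m)) -
        (n * (n - + 1) * (n - + 2) * (n - + 3) + + 2 * (n * (n * (n - + 1) * (n - + 2)))) ≡ + 6 * 0ℤ
    cancel = solve-∀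
    expand : ∀ x e → + 24 * (x + + 8 * e) ≡ + 24 * x + + 12 * (+ 16 * e)
    expand = solve-∀
    collect : ∀ n x → + 12 * (n * x) ≡ + 2 * (n * (+ 6 * x))
    collect = solve-∀
    total : + 3 * ((N * + m) * (N * + m)) - + 6 * (N * (+ m * + m) + O) ≡
      N * (N - + 1) * (N - + 2) * (N - + 3) + + 2 * (N * (N * (N - + 1) * (N - + 2)))
    total = begin
      + 3 * ((N * + m) * (N * + m)) - + 6 * (N * (+ m * + m) + O)
        ≡⟨ cong (λ t → + 3 * ((N * + m) * (N * + m)) - + 6 * t) ∑-cycle ⟨
      + 3 * ((N * + m) * (N * + m)) - + 6 * ∑₄ cycle     ≡⟨ ∑-pfaffian² ⟨
      sumTuples 4 (pfaffian² s)
        ≡⟨ sumTuples-subsets 4 pfaffian²-symmetric pfaffian²-alternating ⟩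
      + 24 * sumSubsets 4 (pfaffian² s)                  ≡⟨ cong (_*_ (+ 24)) pf-count ⟩
      + 24 * (+ (n C 4) + + 8 * E)                       ≡⟨ expand (+ (n C 4)) E ⟩
      + 24 * + (n C 4) + + 12 * (+ 16 * E)               ≡⟨ cong₂ (λ t u → t + + 12 * u) (24*nC4 n) E-max ⟩
      N * (N - + 1) * (N - + 2) * (N - + 3) + + 12 * (N * + (n C 3))
        ≡⟨ cong (_+_ (N * (N - + 1) * (N - + 2) * (N - + 3))) (trans (collect N (+ (n C 3))) (cong (λ t → + 2 * (N * t)) (6*nC3 n))) ⟩
      N * (N - + 1) * (N - + 2) * (N - + 3) + + 2 * (N * (N * (N - + 1) * (N - + 2)))  ∎
    sum-off : O ≡ 0ℤ
    sum-off = *-cancelˡ-≡ (+ 6) O 0ℤ (begin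
      + 6 * O  ≡⟨ solve-for-off (+ m) O ⟩
      + 3 * ((N * + m) * (N * + m)) - + 6 * (N * (+ m * + m)) - (+ 3 * ((N * + m) * (N * + m)) - + 6 * (N * (+ m * + m) + O))
        ≡⟨ cong (λ t → + 3 * ((N * + m) * (N * + m)) - + 6 * (N * (+ m * + m)) - t) total ⟩
      + 3 * ((N * + m) * (N * + m)) - + 6 * (N * (+ m * + m)) -
        (N * (N - + 1) * (N - + 2) * (N - + 3) + + 2 * (N * (N * (N - + 1) * (N - + 2))))  ≡⟨ cancel (+ m) ⟩
      + 6 * 0ℤ ∎)

-- Arithmetic modulo a prime

n!≡nCk*k![n-k]! : ∀ {n k} → k ℕ.≤ n → n ! ≡ (n C k) ℕ.* (k ! ℕ.* (n ℕ.∸ k) !)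
n!≡nCk*k![n-k]! {n} {k} k≤n = sym (trans (cong (ℕ._* (k ! ℕ.* (n ℕ.∸ k) !)) (nCk≡n!/k![n-k]! k≤n))
  (ℕ.m/n*n≡m {{k ℕ.!* (n ℕ.∸ k) !≢0}} (subst (ℕ._∣ n !) (ℕ.*-comm ((n ℕ.∸ k) !) (k !)) ([n∸k]!k!∣n! k≤n))))

prime∤! : ∀ {p} → Prime p → ∀ n → n ℕ.< p → ¬ p ℕ.∣ n !
prime∤! {p} pp zero    _ p∣1  = ℕ.nonTrivial⇒≢1 {{prime⇒nonTrivial pp}} (ℕ.∣1⇒≡1 p∣1)
prime∤! {p} pp (suc n) 1+n<p p∣ with euclidsLemma (suc n) (n !) pp p∣
... | inj₁ p∣1+n = ℕ.>⇒∤ 1+n<p p∣1+n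
... | inj₂ p∣n!  = prime∤! pp n (ℕ.<-trans (ℕ.n<1+n n) 1+n<p) p∣n!

n∣n! : ∀ n .{{_ : NonZero n}} → n ℕ.∣ n !
n∣n! (suc n) = ℕ.m∣m*n (n !)

prime∣nCk : ∀ {p} → Prime p → ∀ {k} → 0 ℕ.< k → k ℕ.< p → p ℕ.∣ p C k
prime∣nCk {p} pp {k} 0<k k<p with euclidsLemma (p C k) (k ! ℕ.* (p ℕ.∸ k) !) pp
  (subst (p ℕ.∣_) (n!≡nCk*k![n-k]! (ℕ.<⇒≤ k<p)) (n∣n! p {{prime⇒nonZero pp}}))
... | inj₁ p∣C = p∣C
... | inj₂ p∣! with euclidsLemma (k !) ((p ℕ.∸ k) !) pp p∣!
...   | inj₁ p∣k! = contradiction p∣k! (prime∤! pp k k<p)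
...   | inj₂ p∣[p-k]! = contradiction p∣[p-k]! (prime∤! pp (p ℕ.∸ k) (ℕ.∸-monoʳ-< 0<k (ℕ.<⇒≤ k<p)))

prime∤nCk : ∀ {p} → Prime p → ∀ {n k} → k ℕ.≤ n → n ℕ.< p → ¬ p ℕ.∣ n C k
prime∤nCk {p} pp {n} {k} k≤n n<p p∣C = prime∤! pp n n<p
  (subst (p ℕ.∣_) (sym (n!≡nCk*k![n-k]! k≤n)) (ℕ.∣m⇒∣m*n (k ! ℕ.* (n ℕ.∸ k) !) p∣C))

pos-^ : ∀ m n → + (m ℕ.^ n) ≡ (+ m) ^ n
pos-^ m zero    = refl
pos-^ m (suc n) = trans (pos-* m (m ℕ.^ n)) (cong (_*_ (+ m)) (pos-^ m n))

∑-telescope : ∀ n (g : ℕ → ℤ) → ∑[ i < n ] g (suc (toℕ i)) + g 0 ≡ ∑[ i < n ] g (toℕ i) + g n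
∑-telescope zero    g = refl
∑-telescope (suc n) g = begin
  g 1 + ∑[ i < n ] g (2 ℕ.+ toℕ i) + g 0    ≡⟨ rearrange (g 1) (∑[ i < n ] g (2 ℕ.+ toℕ i)) (g 0) ⟩
  g 0 + (∑[ i < n ] g (2 ℕ.+ toℕ i) + g 1)  ≡⟨ cong (_+_ (g 0)) (∑-telescope n (g ∘ suc)) ⟩
  g 0 + (∑[ i < n ] g (suc (toℕ i)) + g (suc n))  ≡⟨ +-assoc (g 0) _ _ ⟨
  g 0 + ∑[ i < n ] g (suc (toℕ i)) + g (suc n)  ∎
  where
  open ≡-Reasoning
  rearrange : ∀ x y z → x + y + z ≡ z + (y + x)
  rearrange = solve-∀

∑-last : ∀ n (t : ℕ → ℤ) → ∑[ i < suc n ] t (toℕ i) ≡ ∑[ i < n ] t (toℕ i) + t n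
∑-last zero    t = +-comm (t 0) 0ℤ
∑-last (suc n) t = trans (cong (_+_ (t 0)) (∑-last n (t ∘ suc))) (sym (+-assoc (t 0) _ _))

·≡* : ∀ n x → n · x ≡ + n * x
·≡* zero    x = refl
·≡* (suc n) x = trans (cong (_+_ x) (·≡* n x)) (sym (suc-* (+ n) x))

binomial : ∀ n x y → (x + y) ^ n ≡ ∑[ k ≤ n ] (+ (n C toℕ k) * (x ^ toℕ k * y ^ (n ℕ.∸ toℕ k)))
binomial n x y = trans (Binomial.theorem n x y) (sum-cong-≗ {suc n} λ k → ·≡* (n C toℕ k) (x ^ toℕ k * y ^ (n ℕ.∸ toℕ k)))

1^n≡1 : ∀ n → 1ℤ ^ n ≡ 1ℤ
1^n≡1 zero    = refl
1^n≡1 (suc n) = trans (*-identityˡ (1ℤ ^ n)) (1^n≡1 n)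

n∸m≡n-m : ∀ {m n} → m ℕ.≤ n → + (n ℕ.∸ m) ≡ + n - + m
n∸m≡n-m {m} {n} m≤n = trans (sym (⊖-≥ m≤n)) (sym (m-n≡m⊖n n m))

-- Integers up to congruence modulo p

module Modular (p : ℕ) where

  infix 4 _≈_

  -- A record, not a synonym for divisibility of `a - b`, so that unification can recover a and b
  -- from a congruence.
  record _≈_ (a b : ℤ) : Set where
    constructor mod
    field difference : + p ∣ a - b
  open _≈_ public

  ≈-reflexive : ∀ {a b} → a ≡ b → a ≈ b
  ≈-reflexive {a} refl = mod (divides 0ℤ (+-inverseʳ a))

  private
    ≈-sym : ∀ {a b} → a ≈ b → b ≈ a
    ≈-sym {a} {b} (mod d) = mod (subst (+ p ∣_) (ring a b) (∣m⇒∣-m d))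
      where
      ring : ∀ a b → - (a - b) ≡ b - a
      ring = solve-∀

    ≈-trans : ∀ {a b c} → a ≈ b → b ≈ c → a ≈ c
    ≈-trans {a} {b} {c} (mod d) (mod e) = mod (subst (+ p ∣_) (ring a b c) (∣m∣n⇒∣m+n d e))
      where
      ring : ∀ a b c → (a - b) + (b - c) ≡ a - c
      ring = solve-∀

    ≈-+-cong : ∀ {a b c d} → a ≈ b → c ≈ d → a + c ≈ b + d
    ≈-+-cong {a} {b} {c} {d} (mod u) (mod v) = mod (subst (+ p ∣_) (ring a b c d) (∣m∣n⇒∣m+n u v))
      where
      ring : ∀ a b c d → (a - b) + (c - d) ≡ (a + c) - (b + d)
      ring = solve-∀

    ≈-*-cong : ∀ {a b c d} → a ≈ b → c ≈ d → a * c ≈ b * d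
    ≈-*-cong {a} {b} {c} {d} (mod u) (mod v) =
      mod (subst (+ p ∣_) (ring a b c d) (∣m∣n⇒∣m+n (∣m⇒∣m*n c u) (∣n⇒∣m*n b v)))
      where
      ring : ∀ a b c d → (a - b) * c + b * (c - d) ≡ a * c - b * d
      ring = solve-∀

    ≈-neg-cong : ∀ {a b} → a ≈ b → - a ≈ - b
    ≈-neg-cong {a} {b} (mod d) = mod (subst (+ p ∣_) (ring a b) (∣m⇒∣-m d))
      where
      ring : ∀ a b → - (a - b) ≡ - a - - b
      ring = solve-∀

  -- The operations are those of ℤ and only the equality is coarser. Thus exact identities, also
  -- those from the integer ring solver, can be mixed freely with congruences.
  ℤ/p : CommutativeRing 0ℓ 0ℓ
  ℤ/p = record
    { Carrier = ℤ ; _≈_ = _≈_ ; _+_ = _+_ ; _*_ = _*_ ; -_ = -_ ; 0# = 0ℤ ; 1# = 1ℤ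
    ; isCommutativeRing = record
      { isRing = record
        { +-isAbelianGroup = record
          { isGroup = record
            { isMonoid = record
              { isSemigroup = record
                { isMagma = record
                  { isEquivalence = record { refl = ≈-reflexive refl ; sym = ≈-sym ; trans = ≈-trans }
                  ; ∙-cong = ≈-+-cong }
                ; assoc = λ a b c → ≈-reflexive (+-assoc a b c) }
              ; identity = ≈-reflexive ∘ +-identityˡ , ≈-reflexive ∘ +-identityʳ }
            ; inverse = ≈-reflexive ∘ +-inverseˡ , ≈-reflexive ∘ +-inverseʳ
            ; ⁻¹-cong = ≈-neg-cong }
          ; comm = λ a b → ≈-reflexive (+-comm a b) }
        ; *-cong = ≈-*-cong
        ; *-assoc = λ a b c → ≈-reflexive (*-assoc a b c)
        ; *-identity = ≈-reflexive ∘ *-identityˡ , ≈-reflexive ∘ *-identityʳ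
        ; distrib = (λ a b c → ≈-reflexive (*-distribˡ-+ a b c)) , (λ a b c → ≈-reflexive (*-distribʳ-+ a b c)) }
      ; *-comm = λ a b → ≈-reflexive (*-comm a b) } }

  module ℤₚ where
    open CommutativeRing ℤ/p public
    open import Algebra.Properties.Semiring.Sum semiring public
      using (sum-cong-≋)
    open import Relation.Binary.Reasoning.Setoid setoid public

  ∣⇒≈0 : ∀ {n} → p ℕ.∣ n → + n ≈ 0ℤ
  ∣⇒≈0 {n} p∣n = mod (subst (+ p ∣_) (sym (+-identityʳ (+ n))) (∣ᵤ⇒∣ p∣n))

  ≈0⇒∣ : ∀ {a} → a ≈ 0ℤ → p ℕ.∣ ∣ a ∣
  ≈0⇒∣ {a} (mod d) = ∣⇒∣ᵤ (subst (+ p ∣_) (+-identityʳ a) d)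

  -≈0⇒≈ : ∀ {a b} → a - b ≈ 0ℤ → a ≈ b
  -≈0⇒≈ {a} {b} (mod d) = mod (subst (+ p ∣_) (+-identityʳ (a - b)) d)

  ^-cong-≈ : ∀ n {a b} → a ≈ b → a ^ n ≈ b ^ n
  ^-cong-≈ zero    a≈b = ℤₚ.refl
  ^-cong-≈ (suc n) a≈b = ≈-*-cong a≈b (^-cong-≈ n a≈b)

  ∑-cong-≈ : ∀ {n} {t u : Fin n → ℤ} → (∀ i → t i ≈ u i) → sum t ≈ sum u
  ∑-cong-≈ = ℤₚ.sum-cong-≋

  ∑-≈0 : ∀ {n} {t : Fin n → ℤ} → (∀ i → t i ≈ 0ℤ) → sum t ≈ 0ℤ
  ∑-≈0 {n} t≈0 = ≈-trans (∑-cong-≈ t≈0) (≈-reflexive (sum-replicate-zero n))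

  ∑-single : ∀ {n} (t : Fin n → ℤ) i → (∀ j → j ≢ i → t j ≈ 0ℤ) → sum t ≈ t i
  ∑-single {suc n} t i t≈0 = ℤₚ.begin
    sum t                         ℤₚ.≡⟨ sum-remove {i = i} t ⟩
    t i + sum (t ∘ punchIn i)     ℤₚ.≈⟨ ℤₚ.+-congˡ {t i} (∑-≈0 λ j → t≈0 (punchIn i j) (punchInᵢ≢i i j)) ⟩
    t i + 0ℤ                      ℤₚ.≡⟨ +-identityʳ (t i) ⟩
    t i                           ℤₚ.∎

  ∑-singleℕ : ∀ {n} (t : ℕ → ℤ) {k} → k ℕ.< n → (∀ j → j ℕ.< n → j ≢ k → t j ≈ 0ℤ) → ∑[ i < n ] t (toℕ i) ≈ t k
  ∑-singleℕ {n} t {k} k<n t≈0 = ≈-trans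
    (∑-single (t ∘ toℕ) (fromℕ< k<n) λ j j≢k → t≈0 (toℕ j) (toℕ<n j) λ j≡k →
      j≢k (toℕ-injective (trans j≡k (sym (toℕ-fromℕ< k<n)))))
    (≈-reflexive (cong t (toℕ-fromℕ< k<n)))

  -- Fermat's theorem, power sums and binomial coefficients modulo a prime

  module _ (pp : Prime p) where

    private
      instance
        p≢0 : NonZero p
        p≢0 = prime⇒nonZero pp

      0<p : 0 ℕ.< p
      0<p = ℕ.>-nonZero⁻¹ p

      p≈0 : + p ≈ 0ℤ
      p≈0 = ∣⇒≈0 ℕ.∣-refl

    *≈0 : ∀ a b → a * b ≈ 0ℤ → a ≈ 0ℤ ⊎ b ≈ 0ℤ
    *≈0 a b ab≈0 with euclidsLemma ∣ a ∣ ∣ b ∣ pp (subst (p ℕ.∣_) (abs-* a b) (≈0⇒∣ ab≈0))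
    ... | inj₁ p∣a = inj₁ (mod (subst (+ p ∣_) (sym (+-identityʳ a)) (∣ᵤ⇒∣ p∣a)))
    ... | inj₂ p∣b = inj₂ (mod (subst (+ p ∣_) (sym (+-identityʳ b)) (∣ᵤ⇒∣ p∣b)))

    <p⇒≉0 : ∀ {n} .{{_ : NonZero n}} → n ℕ.< p → ¬ + n ≈ 0ℤ
    <p⇒≉0 n<p n≈0 = ℕ.>⇒∤ n<p (≈0⇒∣ n≈0)

    frobenius : ∀ x y → (x + y) ^ p ≈ x ^ p + y ^ p
    frobenius x y = ℤₚ.begin
      (x + y) ^ p                        ℤₚ.≡⟨ binomial p x y ⟩
      ∑[ k ≤ p ] t (toℕ k)               ℤₚ.≡⟨ ∑-last p t ⟩
      ∑[ k < p ] t (toℕ k) + t p         ℤₚ.≈⟨ ≈-+-cong (∑-singleℕ t 0<p middle) (≈-reflexive last) ⟩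
      t 0 + x ^ p
        ℤₚ.≡⟨ cong (_+ x ^ p) (trans (*-identityˡ (1ℤ * y ^ p)) (*-identityˡ (y ^ p))) ⟩
      y ^ p + x ^ p                      ℤₚ.≡⟨ +-comm (y ^ p) (x ^ p) ⟩
      x ^ p + y ^ p                      ℤₚ.∎
      where
      t : ℕ → ℤ
      t k = + (p C k) * (x ^ k * y ^ (p ℕ.∸ k))
      middle : ∀ k → k ℕ.< p → k ≢ 0 → t k ≈ 0ℤ
      middle k k<p k≢0 = ℤₚ.trans (ℤₚ.*-congʳ (∣⇒≈0 (prime∣nCk pp (ℕ.n≢0⇒n>0 k≢0) k<p))) (ℤₚ.zeroˡ (x ^ k * y ^ (p ℕ.∸ k)))
      last : t p ≡ x ^ p
      last = trans (cong₂ (λ c e → + c * (x ^ p * y ^ e)) (nCn≡1 p) (ℕ.n∸n≡0 p)) (trans (*-identityˡ _) (*-identityʳ _))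

    0^n≡0 : ∀ n .{{_ : NonZero n}} → 0ℤ ^ n ≡ 0ℤ
    0^n≡0 (suc n) = refl

    fermat : ∀ n → (+ n) ^ p ≈ + n
    fermat zero    = ≈-reflexive (0^n≡0 p)
    fermat (suc n) = ℤₚ.begin
      (1ℤ + + n) ^ p      ℤₚ.≈⟨ frobenius 1ℤ (+ n) ⟩
      1ℤ ^ p + (+ n) ^ p    ℤₚ.≈⟨ ≈-+-cong (≈-reflexive (1^n≡1 p)) (fermat n) ⟩
      1ℤ + + n            ℤₚ.∎

    fermat-unit : ∀ {q} → p ≡ suc q → ∀ n → ¬ + n ≈ 0ℤ → (+ n) ^ q ≈ 1ℤ
    fermat-unit {q} p≡1+q n n≉0 = [ (λ n≈0 → contradiction n≈0 n≉0) , -≈0⇒≈ ]′ (*≈0 (+ n) ((+ n) ^ q - 1ℤ) product≈0)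
      where
      ring : ∀ x y → x * (y - 1ℤ) ≡ x * y - x
      ring = solve-∀
      product≈0 : + n * ((+ n) ^ q - 1ℤ) ≈ 0ℤ
      product≈0 = ℤₚ.begin
        + n * ((+ n) ^ q - 1ℤ)  ℤₚ.≡⟨ ring (+ n) ((+ n) ^ q) ⟩
        (+ n) ^ suc q - + n     ℤₚ.≡⟨ cong (λ e → (+ n) ^ e - + n) p≡1+q ⟨
        (+ n) ^ p - + n         ℤₚ.≈⟨ ℤₚ.+-congʳ { - + n} (fermat n) ⟩
        + n - + n               ℤₚ.≡⟨ +-inverseʳ (+ n) ⟩
        0ℤ                      ℤₚ.∎

    powerSum : ℕ → ℤ
    powerSum m = ∑[ x < p ] ((+ toℕ x) ^ m)

    -- The sum of (x+1)^(m+1) - x^(m+1) over x < p telescopes to p^(m+1) ≈ 0; expanding the first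
    -- power binomially cancels the top terms and leaves the lower power sums.
    powerSum-recurrence : ∀ m → ∑[ k ≤ m ] (+ (suc m C toℕ k) * powerSum (toℕ k)) ≈ 0ℤ
    powerSum-recurrence m = ℤₚ.begin
      A                                ℤₚ.≡⟨ ring A G ⟩
      -- The summand 0ℤ is `g 0`, in the shape that `∑-telescope` expects.
      (A + G) + 0ℤ - G                 ℤₚ.≡⟨ cong (λ t → t + 0ℤ - G) expand ⟨
      ∑[ x < p ] g (suc (toℕ x)) + 0ℤ - G  ℤₚ.≡⟨ cong (_- G) (∑-telescope p g) ⟩
      G + g p - G
        ℤₚ.≈⟨ ℤₚ.+-congʳ { - G} (ℤₚ.+-congˡ {G} (ℤₚ.trans (ℤₚ.*-congʳ p≈0) (ℤₚ.zeroˡ ((+ p) ^ m)))) ⟩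
      G + 0ℤ - G                       ℤₚ.≡⟨ ring′ G ⟩
      0ℤ                               ℤₚ.∎
      where
      g : ℕ → ℤ
      g n = (+ n) ^ suc m
      A = ∑[ k ≤ m ] (+ (suc m C toℕ k) * powerSum (toℕ k))
      G = ∑[ x < p ] g (toℕ x)
      ring : ∀ a g → a ≡ (a + g) + 0ℤ - g
      ring = solve-∀
      ring′ : ∀ g → g + 0ℤ - g ≡ 0ℤ
      ring′ = solve-∀
      t : ℤ → ℕ → ℤ
      t x k = + (suc m C k) * x ^ k
      expand₁ : ∀ x → (1ℤ + x) ^ suc m ≡ ∑[ k ≤ m ] t x (toℕ k) + x ^ suc m
      expand₁ x = begin
        (1ℤ + x) ^ suc m                                      ≡⟨ cong (_^ suc m) (+-comm 1ℤ x) ⟩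
        (x + 1ℤ) ^ suc m                                      ≡⟨ binomial (suc m) x 1ℤ ⟩
        ∑[ k ≤ suc m ] (+ (suc m C toℕ k) * (x ^ toℕ k * 1ℤ ^ (suc m ℕ.∸ toℕ k)))
          ≡⟨ sum-cong-≗ {suc (suc m)} (λ k → cong (_*_ (+ (suc m C toℕ k))) (trans (cong (_*_ (x ^ toℕ k)) (1^n≡1 (suc m ℕ.∸ toℕ k))) (*-identityʳ (x ^ toℕ k)))) ⟩
        ∑[ k ≤ suc m ] t x (toℕ k)                            ≡⟨ ∑-last (suc m) (t x) ⟩
        ∑[ k ≤ m ] t x (toℕ k) + t x (suc m)
          ≡⟨ cong (_+_ (∑[ k ≤ m ] t x (toℕ k))) (trans (cong (λ c → + c * x ^ suc m) (nCn≡1 (suc m))) (*-identityˡ (x ^ suc m))) ⟩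
        ∑[ k ≤ m ] t x (toℕ k) + x ^ suc m                    ∎
        where open ≡-Reasoning
      expand : ∑[ x < p ] g (suc (toℕ x)) ≡ A + G
      expand = begin
        ∑[ x < p ] g (suc (toℕ x))
          ≡⟨ sum-cong-≗ {p} (λ x → expand₁ (+ toℕ x)) ⟩
        ∑[ x < p ] (∑[ k ≤ m ] t (+ toℕ x) (toℕ k) + g (toℕ x))
          ≡⟨ ∑-distrib-+ {p} (λ x → ∑[ k ≤ m ] t (+ toℕ x) (toℕ k)) (g ∘ toℕ) ⟩
        ∑[ x < p ] ∑[ k ≤ m ] t (+ toℕ x) (toℕ k) + G
          ≡⟨ cong (_+ G) (∑-comm {p} {suc m} (λ x k → t (+ toℕ x) (toℕ k))) ⟩
        ∑[ k ≤ m ] ∑[ x < p ] t (+ toℕ x) (toℕ k) + G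
          ≡⟨ cong (_+ G) (sum-cong-≗ {suc m} λ k → sym (*-distribˡ-sum {p} (+ (suc m C toℕ k)) (λ x → (+ toℕ x) ^ toℕ k))) ⟩
        A + G                                                                 ∎
        where open ≡-Reasoning

    -- By strong induction only the last term of the recurrence survives, and its coefficient C(m+1,
    -- m) is invertible as m + 1 < p. With 0^0 = 1 this includes m = 0, where the sum is p.
    powerSum≈0 : ∀ m → suc m ℕ.< p → powerSum m ≈ 0ℤ
    powerSum≈0 = <-rec _ λ m rec 1+m<p → case m rec 1+m<p
      where
      case : ∀ m → (∀ {k} → k ℕ.< m → suc k ℕ.< p → powerSum k ≈ 0ℤ) → suc m ℕ.< p → powerSum m ≈ 0ℤ
      case m rec 1+m<p = [ (λ C≈0 → contradiction (≈0⇒∣ C≈0) (prime∤nCk pp (ℕ.n≤1+n m) 1+m<p)) , id ]′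
        (*≈0 (+ (suc m C m)) (powerSum m) last≈0)
        where
        t : ℕ → ℤ
        t k = + (suc m C k) * powerSum k
        lower≈0 : ∀ k → k ℕ.< suc m → k ≢ m → t k ≈ 0ℤ
        lower≈0 k k<1+m k≢m = ℤₚ.trans
          (ℤₚ.*-congˡ {+ (suc m C k)} (rec (ℕ.≤∧≢⇒< (ℕ.s≤s⁻¹ k<1+m) k≢m) (ℕ.≤-<-trans k<1+m 1+m<p)))
          (ℤₚ.zeroʳ (+ (suc m C k)))
        last≈0 : t m ≈ 0ℤ
        last≈0 = ℤₚ.trans (ℤₚ.sym (∑-singleℕ t (ℕ.n<1+n m) lower≈0)) (powerSum-recurrence m)

    -- Subtracting 1 from each of the p summands changes nothing modulo p. By Fermat it kills every
    -- summand except the one at 0, which becomes -1 because q > 0.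
    powerSum[p-1]≈-1 : ∀ {q} → p ≡ suc q → .{{_ : NonZero q}} → powerSum q ≈ -1ℤ
    powerSum[p-1]≈-1 {q} p≡1+q = ℤₚ.begin
      powerSum q                                    ℤₚ.≡⟨ ring (powerSum q) (∑[ x < p ] -1ℤ) ⟩
      (powerSum q + ∑[ x < p ] -1ℤ) - ∑[ x < p ] -1ℤ
        ℤₚ.≡⟨ cong₂ _-_ (sym (∑-distrib-+ {p} (λ x → (+ toℕ x) ^ q) (λ _ → -1ℤ))) (∑-const p -1ℤ) ⟩
      ∑[ x < p ] ((+ toℕ x) ^ q + -1ℤ) - + p * -1ℤ
        ℤₚ.≈⟨ ≈-+-cong (∑-singleℕ t 0<p nonzero) (≈-neg-cong (ℤₚ.trans (ℤₚ.*-congʳ p≈0) (ℤₚ.zeroˡ -1ℤ))) ⟩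
      t 0 - 0ℤ                                      ℤₚ.≡⟨ cong (λ z → z + -1ℤ - 0ℤ) (0^n≡0 q) ⟩
      -1ℤ                                           ℤₚ.∎
      where
      ring : ∀ a b → a ≡ (a + b) - b
      ring = solve-∀
      t : ℕ → ℤ
      t n = (+ n) ^ q + -1ℤ
      nonzero : ∀ n → n ℕ.< p → n ≢ 0 → t n ≈ 0ℤ
      nonzero n n<p n≢0 = ℤₚ.+-congʳ (fermat-unit p≡1+q n (<p⇒≉0 {{ℕ.≢-nonZero n≢0}} n<p))

    -- Neighbouring entries in row p - 1 of Pascal's triangle add up to an inner entry of row p,
    -- which is divisible by p, so the signs alternate.
    [p-1]Ck≈[-1]^k : ∀ {q} → p ≡ suc q → ∀ k → k ℕ.≤ q → + (q C k) ≈ -1ℤ ^ k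
    [p-1]Ck≈[-1]^k p≡1+q zero    _    = ℤₚ.refl
    [p-1]Ck≈[-1]^k {q} p≡1+q (suc k) k<q = ℤₚ.begin
      + (q C suc k)                                ℤₚ.≡⟨ ring (+ (q C k)) (+ (q C suc k)) ⟩
      (+ (q C k) + + (q C suc k)) - + (q C k)
        ℤₚ.≡⟨ cong (λ c → + c - + (q C k)) (trans (nCk+nC[k+1]≡[n+1]C[k+1] q k) (cong (_C suc k) (sym p≡1+q))) ⟩
      + (p C suc k) - + (q C k)
        ℤₚ.≈⟨ ≈-+-cong (∣⇒≈0 (prime∣nCk pp (ℕ.s≤s ℕ.z≤n) (subst (suc k ℕ.<_) (sym p≡1+q) (ℕ.s≤s k<q)))) (≈-neg-cong ([p-1]Ck≈[-1]^k p≡1+q k (ℕ.<⇒≤ k<q))) ⟩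
      0ℤ - -1ℤ ^ k                                 ℤₚ.≡⟨ ring′ (-1ℤ ^ k) ⟩
      -1ℤ * -1ℤ ^ k                                ℤₚ.∎
      where
      ring : ∀ a b → b ≡ (a + b) - a
      ring = solve-∀
      ring′ : ∀ a → 0ℤ - a ≡ -1ℤ * a
      ring′ = solve-∀

-- Arithmetic of `Fin p` read as congruences

module Residues (p : ℕ) .{{_ : NonZero p}} where
  open Modular p

  toℕ-mod : ∀ n → + toℕ (n ℕ.mod p) ≈ + n
  toℕ-mod n = ℤₚ.sym (ℤₚ.begin
    + n                                    ℤₚ.≡⟨ cong +_ (ℕ.m≡m%n+[m/n]*n n p) ⟩
    + (n ℕ.% p) + + (n ℕ./ p ℕ.* p)        ℤₚ.≈⟨ ℤₚ.+-congˡ {+ (n ℕ.% p)} (∣⇒≈0 (ℕ.n∣m*n (n ℕ./ p))) ⟩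
    + (n ℕ.% p) + 0ℤ                       ℤₚ.≡⟨ +-identityʳ (+ (n ℕ.% p)) ⟩
    + (n ℕ.% p)                            ℤₚ.≡⟨ cong +_ (toℕ-fromℕ< (ℕ.m%n<n n p)) ⟨
    + toℕ (n ℕ.mod p)                      ℤₚ.∎)

  ≈⇒≡ : ∀ {m n} → m ℕ.< p → n ℕ.< p → + m ≈ + n → m ≡ n
  ≈⇒≡ m<p n<p m≈n = ℕ.≤-antisym (≈⇒≤ m<p m≈n) (≈⇒≤ n<p (ℤₚ.sym m≈n))
    where
    ≈⇒≤ : ∀ {m n} → m ℕ.< p → + m ≈ + n → m ℕ.≤ n
    ≈⇒≤ {m} {n} m<p m≈n with ℕ.≤-total m n
    ... | inj₁ m≤n = m≤n
    ... | inj₂ n≤m with m ℕ.∸ n in eq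
    ...   | zero  = ℕ.m∸n≡0⇒m≤n eq
    ...   | suc d = contradiction (subst (p ℕ.∣_) eq (≈0⇒∣ (ℤₚ.begin
      + (m ℕ.∸ n)  ℤₚ.≡⟨ n∸m≡n-m n≤m ⟩
      + m - + n    ℤₚ.≈⟨ ℤₚ.+-congʳ { - + n} m≈n ⟩
      + n - + n    ℤₚ.≡⟨ +-inverseʳ (+ n) ⟩
      0ℤ           ℤₚ.∎))) (ℕ.>⇒∤ (subst (ℕ._< p) eq (ℕ.≤-<-trans (ℕ.m∸n≤m m n) m<p)))

  toℕ-≈-injective : ∀ {a b : Fin p} → + toℕ a ≈ + toℕ b → a ≡ b
  toℕ-≈-injective {a} {b} a≈b = toℕ-injective (≈⇒≡ (toℕ<n a) (toℕ<n b) a≈b)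

  toℕ-∸ : ∀ (x : Fin p) → + (p ℕ.∸ toℕ x) ≈ - + toℕ x
  toℕ-∸ x = ℤₚ.begin
    + (p ℕ.∸ toℕ x)     ℤₚ.≡⟨ n∸m≡n-m (ℕ.<⇒≤ (toℕ<n x)) ⟩
    + p - + toℕ x       ℤₚ.≈⟨ ℤₚ.+-congʳ { - + toℕ x} (∣⇒≈0 ℕ.∣-refl) ⟩
    0ℤ - + toℕ x        ℤₚ.≡⟨ +-identityˡ (- + toℕ x) ⟩
    - + toℕ x           ℤₚ.∎

  toℕ-neg : ∀ x → + toℕ (negₚ p x) ≈ - + toℕ x
  toℕ-neg x = ℤₚ.trans (toℕ-mod (p ℕ.∸ toℕ x)) (toℕ-∸ x)

  toℕ-- : ∀ y x → + toℕ (_-ₚ_ p y x) ≈ + toℕ y - + toℕ x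
  toℕ-- y x = ℤₚ.trans (toℕ-mod (toℕ y ℕ.+ (p ℕ.∸ toℕ x))) (ℤₚ.+-congˡ {+ toℕ y} (toℕ-∸ x))

  toℕ-0 : + toℕ (0ₚ p) ≈ 0ℤ
  toℕ-0 = toℕ-mod 0

  infixl 6 _⊖ₚ_
  _⊖ₚ_ : Fin p → Fin p → Fin p
  _⊖ₚ_ = _-ₚ_ p

  -- w ⊖ₚ negₚ z plays the role of w + z.
  shift : Fin p → Permutation′ p
  shift z = permutation (_⊖ₚ negₚ p z) (_⊖ₚ z)
    (λ y → toℕ-≈-injective (ℤₚ.begin
      + toℕ (y ⊖ₚ z ⊖ₚ negₚ p z)                   ℤₚ.≈⟨ toℕ-- (y ⊖ₚ z) (negₚ p z) ⟩
      + toℕ (y ⊖ₚ z) - + toℕ (negₚ p z)            ℤₚ.≈⟨ ℤₚ.+-cong (toℕ-- y z) (ℤₚ.-‿cong (toℕ-neg z)) ⟩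
      + toℕ y - + toℕ z - - + toℕ z                ℤₚ.≡⟨ ring (+ toℕ y) (+ toℕ z) ⟩
      + toℕ y                                      ℤₚ.∎))
    (λ y → toℕ-≈-injective (ℤₚ.begin
      + toℕ (y ⊖ₚ negₚ p z ⊖ₚ z)                   ℤₚ.≈⟨ toℕ-- (y ⊖ₚ negₚ p z) z ⟩
      + toℕ (y ⊖ₚ negₚ p z) - + toℕ z
        ℤₚ.≈⟨ ℤₚ.+-congʳ { - + toℕ z} (ℤₚ.trans (toℕ-- y (negₚ p z)) (ℤₚ.+-congˡ {+ toℕ y} (ℤₚ.-‿cong (toℕ-neg z)))) ⟩
      + toℕ y - - + toℕ z - + toℕ z                ℤₚ.≡⟨ ring′ (+ toℕ y) (+ toℕ z) ⟩
      + toℕ y                                      ℤₚ.∎))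
    where
    ring : ∀ y z → y - z - - z ≡ y
    ring = solve-∀
    ring′ : ∀ y z → y - - z - z ≡ y
    ring′ = solve-∀

  toℕ-shift : ∀ z w → + toℕ (w ⊖ₚ negₚ p z) ≈ + toℕ z + + toℕ w
  toℕ-shift z w = ℤₚ.begin
    + toℕ (w ⊖ₚ negₚ p z)            ℤₚ.≈⟨ toℕ-- w (negₚ p z) ⟩
    + toℕ w - + toℕ (negₚ p z)       ℤₚ.≈⟨ ℤₚ.+-congˡ {+ toℕ w} (ℤₚ.-‿cong (toℕ-neg z)) ⟩
    + toℕ w - - + toℕ z              ℤₚ.≡⟨ ring (+ toℕ w) (+ toℕ z) ⟩
    + toℕ z + + toℕ w                ℤₚ.∎
    where
    ring : ∀ w z → w - - z ≡ z + w
    ring = solve-∀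

  -- Moments of a function whose self-convolution is constantly 1

  module _ (pp : Prime p) (f : Fin p → ℤ)
    (conv : ∀ y → ∑[ z < p ] (f z * f (y ⊖ₚ z)) ≈ 1ℤ) where

    moment : ℕ → ℤ
    moment j = ∑[ x < p ] (f x * (+ toℕ x) ^ j)

    -- Substituting y = z + w makes the weight (z + w)^m, and the binomial theorem separates the two
    -- variables into a product of moments.
    moment-convolution : ∀ m → ∑[ k ≤ m ] (+ (m C toℕ k) * (moment (toℕ k) * moment (m ℕ.∸ toℕ k))) ≈ powerSum pp m
    moment-convolution m = ℤₚ.sym (ℤₚ.begin
      ∑[ y < p ] ((+ toℕ y) ^ m)
        ℤₚ.≡⟨ sum-cong-≗ {p} (λ y → sym (*-identityʳ ((+ toℕ y) ^ m))) ⟩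
      ∑[ y < p ] ((+ toℕ y) ^ m * 1ℤ)
        ℤₚ.≈⟨ ∑-cong-≈ {p} (λ y → ℤₚ.*-congˡ {(+ toℕ y) ^ m} (conv y)) ⟨
      ∑[ y < p ] ((+ toℕ y) ^ m * ∑[ z < p ] (f z * f (y ⊖ₚ z)))
        ℤₚ.≡⟨ sum-cong-≗ {p} (λ y → *-distribˡ-sum {p} ((+ toℕ y) ^ m) (λ z → f z * f (y ⊖ₚ z))) ⟩
      ∑[ y < p ] ∑[ z < p ] ((+ toℕ y) ^ m * (f z * f (y ⊖ₚ z)))
        ℤₚ.≡⟨ ∑-comm {p} {p} (λ y z → (+ toℕ y) ^ m * (f z * f (y ⊖ₚ z))) ⟩
      ∑[ z < p ] ∑[ y < p ] ((+ toℕ y) ^ m * (f z * f (y ⊖ₚ z)))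
        -- For fixed z the map w ↦ w + z permutes the residues; below, `inverseˡ` reduces (w + z) -
        -- z to w inside f.
        ℤₚ.≡⟨ sum-cong-≗ {p} (λ z → sum-permute (λ y → (+ toℕ y) ^ m * (f z * f (y ⊖ₚ z))) (shift z)) ⟩
      ∑[ z < p ] ∑[ w < p ] ((+ toℕ (w ⊖ₚ negₚ p z)) ^ m * (f z * f (w ⊖ₚ negₚ p z ⊖ₚ z)))
        ℤₚ.≈⟨ ∑-cong-≈ {p} (λ z → ∑-cong-≈ {p} λ w → ℤₚ.*-cong (^-cong-≈ m (toℕ-shift z w))
                (ℤₚ.*-congˡ {f z} (ℤₚ.reflexive (cong f (inverseˡ (shift z) {w}))))) ⟩
      ∑[ z < p ] ∑[ w < p ] ((+ toℕ z + + toℕ w) ^ m * (f z * f w))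
        ℤₚ.≡⟨ sum-cong-≗ {p} (λ z → sum-cong-≗ {p} λ w → expand z w) ⟩
      ∑[ z < p ] ∑[ w < p ] ∑[ k ≤ m ] t z w k
        ℤₚ.≡⟨ sum-cong-≗ {p} (λ z → ∑-comm {p} {suc m} (t z)) ⟩
      ∑[ z < p ] ∑[ k ≤ m ] ∑[ w < p ] t z w k
        ℤₚ.≡⟨ ∑-comm {p} {suc m} (λ z k → ∑[ w < p ] t z w k) ⟩
      ∑[ k ≤ m ] ∑[ z < p ] ∑[ w < p ] t z w k
        ℤₚ.≡⟨ sum-cong-≗ {suc m} (λ k → collect k) ⟩
      ∑[ k ≤ m ] (+ (m C toℕ k) * (moment (toℕ k) * moment (m ℕ.∸ toℕ k))) ℤₚ.∎)
      where
      u : Fin p → ℕ → ℤ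
      u x j = f x * (+ toℕ x) ^ j
      t : Fin p → Fin p → Fin (suc m) → ℤ
      t z w k = + (m C toℕ k) * (u z (toℕ k) * u w (m ℕ.∸ toℕ k))
      ring : ∀ c x y a b → c * (x * y) * (a * b) ≡ c * ((a * x) * (b * y))
      ring = solve-∀
      expand : ∀ z w → (+ toℕ z + + toℕ w) ^ m * (f z * f w) ≡ ∑[ k ≤ m ] t z w k
      expand z w = trans (cong (_* (f z * f w)) (binomial m (+ toℕ z) (+ toℕ w)))
        (trans (*-distribʳ-sum {suc m} (f z * f w) (λ k → + (m C toℕ k) * ((+ toℕ z) ^ toℕ k * (+ toℕ w) ^ (m ℕ.∸ toℕ k))))
          (sum-cong-≗ {suc m} λ k → ring (+ (m C toℕ k)) ((+ toℕ z) ^ toℕ k) ((+ toℕ w) ^ (m ℕ.∸ toℕ k)) (f z) (f w)))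
      collect : ∀ k → ∑[ z < p ] ∑[ w < p ] t z w k ≡ + (m C toℕ k) * (moment (toℕ k) * moment (m ℕ.∸ toℕ k))
      collect k = trans
        (sum-cong-≗ {p} λ z → sym (*-distribˡ-sum {p} (+ (m C toℕ k)) (λ w → u z (toℕ k) * u w (m ℕ.∸ toℕ k))))
        (trans (sym (*-distribˡ-sum {p} (+ (m C toℕ k)) (λ z → ∑[ w < p ] (u z (toℕ k) * u w (m ℕ.∸ toℕ k)))))
          (cong (_*_ (+ (m C toℕ k))) (∑-product {p} {p} (λ z → u z (toℕ k)) (λ w → u w (m ℕ.∸ toℕ k)))))

    -- In degree 2j every term but the middle one contains a moment of index below j: either k < j
    -- or 2j - k < j.
    central-moment : ∀ j → (∀ {i} → i ℕ.< j → moment i ≈ 0ℤ) →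
      + ((j ℕ.+ j) C j) * (moment j * moment j) ≈ powerSum pp (j ℕ.+ j)
    central-moment j lower≈0 = ℤₚ.begin
      + ((j ℕ.+ j) C j) * (moment j * moment j)
        ℤₚ.≡⟨ cong (λ i → + ((j ℕ.+ j) C j) * (moment j * moment i)) (ℕ.m+n∸n≡m j j) ⟨
      t j                                         ℤₚ.≈⟨ ∑-singleℕ t (ℕ.s≤s (ℕ.m≤m+n j j)) other ⟨
      ∑[ k ≤ j ℕ.+ j ] t (toℕ k)                  ℤₚ.≈⟨ moment-convolution (j ℕ.+ j) ⟩
      powerSum pp (j ℕ.+ j)                       ℤₚ.∎
      where
      t : ℕ → ℤ
      t k = + ((j ℕ.+ j) C k) * (moment k * moment (j ℕ.+ j ℕ.∸ k))
      vanish : ∀ c a b → a ≈ 0ℤ ⊎ b ≈ 0ℤ → c * (a * b) ≈ 0ℤ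
      vanish c a b (inj₁ a≈0) = ℤₚ.trans (ℤₚ.*-congˡ {c} (ℤₚ.trans (ℤₚ.*-congʳ a≈0) (ℤₚ.zeroˡ b))) (ℤₚ.zeroʳ c)
      vanish c a b (inj₂ b≈0) = ℤₚ.trans (ℤₚ.*-congˡ {c} (ℤₚ.trans (ℤₚ.*-congˡ {a} b≈0) (ℤₚ.zeroʳ a))) (ℤₚ.zeroʳ c)
      other : ∀ k → k ℕ.< suc (j ℕ.+ j) → k ≢ j → t k ≈ 0ℤ
      other k k<1+2j k≢j with ℕ.<-cmp k j
      ... | tri< k<j _ _ = vanish (+ ((j ℕ.+ j) C k)) (moment k) (moment (j ℕ.+ j ℕ.∸ k)) (inj₁ (lower≈0 k<j))
      ... | tri≈ _ k≡j _ = contradiction k≡j k≢j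
      ... | tri> _ _ j<k = vanish (+ ((j ℕ.+ j) C k)) (moment k) (moment (j ℕ.+ j ℕ.∸ k)) (inj₂ (lower≈0
              (subst (j ℕ.+ j ℕ.∸ k ℕ.<_) (ℕ.m+n∸n≡m j j) (ℕ.∸-monoʳ-< j<k (ℕ.s≤s⁻¹ k<1+2j)))))

    -- As 2j < p - 1, the power sum of degree 2j vanishes and C(2j, j) is invertible, so the square
    -- of the moment vanishes once all smaller moments do.
    moment≈0 : ∀ j → suc (j ℕ.+ j) ℕ.< p → moment j ≈ 0ℤ
    moment≈0 = <-rec _ λ j rec → step j (λ {i} i<j → rec i<j)
      where
      step : ∀ j → (∀ {i} → i ℕ.< j → suc (i ℕ.+ i) ℕ.< p → moment i ≈ 0ℤ) → suc (j ℕ.+ j) ℕ.< p → moment j ≈ 0ℤ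
      step j rec 1+2j<p = [ (λ C≈0 → contradiction (≈0⇒∣ C≈0) (prime∤nCk pp (ℕ.m≤m+n j j) (ℕ.<-trans (ℕ.n<1+n _) 1+2j<p)))
                          , (λ M²≈0 → [ id , id ]′ (*≈0 pp (moment j) (moment j) M²≈0)) ]′
        (*≈0 pp (+ ((j ℕ.+ j) C j)) (moment j * moment j) product≈0)
        where
        product≈0 : + ((j ℕ.+ j) C j) * (moment j * moment j) ≈ 0ℤ
        product≈0 = ℤₚ.trans
          (central-moment j λ i<j → rec i<j (ℕ.<-trans (ℕ.s≤s (ℕ.+-mono-< i<j i<j)) 1+2j<p))
          (powerSum≈0 pp (j ℕ.+ j) 1+2j<p)

    -- For h = (p - 1)/2 odd: C(p-1, h) ≈ (-1)^h = -1 and ∑ x^(p-1) ≈ -1.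
    moment[h]²≈1 : ∀ {h} → p ≡ suc (h ℕ.+ h) → -1ℤ ^ h ≡ -1ℤ → moment h * moment h ≈ 1ℤ
    moment[h]²≈1 {h} p≡1+2h [-1]^h≡-1 = ℤₚ.begin
      moment h * moment h                                  ℤₚ.≡⟨ ring (moment h * moment h) ⟩
      - (-1ℤ * (moment h * moment h))
        ℤₚ.≡⟨ cong (λ c → - (c * (moment h * moment h))) [-1]^h≡-1 ⟨
      - (-1ℤ ^ h * (moment h * moment h))
        ℤₚ.≈⟨ ℤₚ.-‿cong (ℤₚ.*-congʳ ([p-1]Ck≈[-1]^k pp p≡1+2h h (ℕ.m≤m+n h h))) ⟨
      - (+ ((h ℕ.+ h) C h) * (moment h * moment h))
        ℤₚ.≈⟨ ℤₚ.-‿cong (central-moment h λ {i} i<h → moment≈0 i (subst (suc (i ℕ.+ i) ℕ.<_) (sym p≡1+2h) (ℕ.s≤s (ℕ.+-mono-< i<h i<h)))) ⟩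
      - powerSum pp (h ℕ.+ h)
        ℤₚ.≈⟨ ℤₚ.-‿cong (powerSum[p-1]≈-1 pp p≡1+2h {{ℕ.≢-nonZero (2h≢0 h [-1]^h≡-1)}}) ⟩
      1ℤ                                                   ℤₚ.∎
      where
      ring : ∀ x → x ≡ - (-1ℤ * x)
      ring = solve-∀
      2h≢0 : ∀ h → -1ℤ ^ h ≡ -1ℤ → h ℕ.+ h ≢ 0
      2h≢0 zero () _
      2h≢0 (suc h) _ ()

-- The quadratic character

[-1]^odd : ∀ t → -1ℤ ^ suc (t ℕ.+ t) ≡ -1ℤ
[-1]^odd zero    = refl
[-1]^odd (suc t) = trans (cong (λ e → -1ℤ ^ suc (suc e)) (ℕ.+-suc t t))
  (trans (ring (-1ℤ ^ suc (t ℕ.+ t))) ([-1]^odd t))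
  where
  ring : ∀ x → -1ℤ * (-1ℤ * x) ≡ x
  ring = solve-∀

[x*x]^n≡x^[n+n] : ∀ x n → (x * x) ^ n ≡ x ^ (n ℕ.+ n)
[x*x]^n≡x^[n+n] x zero    = refl
[x*x]^n≡x^[n+n] x (suc n) = trans (cong (_*_ (x * x)) ([x*x]^n≡x^[n+n] x n))
  (trans (*-assoc x x _) (cong (λ e → x * x ^ e) (sym (ℕ.+-suc n n))))

0≤ind : ∀ {a} {P : Set a} (P? : Dec P) → 0ℤ ≤ ind P?
0≤ind (yes _) = +≤+ ℕ.z≤n
0≤ind (no _)  = +≤+ ℕ.z≤n

0≤1-ind : ∀ {a} {P : Set a} (P? : Dec P) → 0ℤ ≤ 1ℤ - ind P?
0≤1-ind (yes _) = +≤+ ℕ.z≤n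
0≤1-ind (no _)  = +≤+ ℕ.z≤n

1-ind≡0⇒ : ∀ {a} {P : Set a} (P? : Dec P) → 1ℤ - ind P? ≡ 0ℤ → P
1-ind≡0⇒ (yes p) _ = p

IsSign : ℤ → Set
IsSign i = i ≡ 1ℤ ⊎ i ≡ -1ℤ

neg-sign : ∀ {i} → IsSign i → IsSign (- i)
neg-sign (inj₁ refl) = inj₂ refl
neg-sign (inj₂ refl) = inj₁ refl

module QuadraticCharacter (p : ℕ) .{{_ : NonZero p}} (pp : Prime p) where
  open Modular p
  open Residues p

  -- Each case carries both the evidence and the value of χ, so later case distinctions need not
  -- unfold the nested conditionals.
  data χ-View (x : Fin p) : Set where
    at-zero   : x ≡ 0ₚ p → χ p x ≡ 0ℤ → χ-View x
    square    : x ≢ 0ₚ p → IsSquare p x → χ p x ≡ 1ℤ → χ-View x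
    nonsquare : x ≢ 0ₚ p → ¬ IsSquare p x → χ p x ≡ -1ℤ → χ-View x

  χ-zero : ∀ {x} → x ≡ 0ₚ p → χ p x ≡ 0ℤ
  χ-zero {x} x≡0 with x Fin.≟ 0ₚ p
  ... | yes _  = refl
  ... | no x≢0 = contradiction x≡0 x≢0

  χ-square : ∀ {x} → x ≢ 0ₚ p → IsSquare p x → χ p x ≡ 1ℤ
  χ-square {x} x≢0 sq with x Fin.≟ 0ₚ p | isSquare? p x
  ... | yes x≡0 | _      = contradiction x≡0 x≢0
  ... | no _    | yes _  = refl
  ... | no _    | no ¬sq = contradiction sq ¬sq

  χ-nonsquare : ∀ {x} → x ≢ 0ₚ p → ¬ IsSquare p x → χ p x ≡ -1ℤ
  χ-nonsquare {x} x≢0 ¬sq with x Fin.≟ 0ₚ p | isSquare? p x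
  ... | yes x≡0 | _      = contradiction x≡0 x≢0
  ... | no _    | yes sq = contradiction sq ¬sq
  ... | no _    | no _   = refl

  χ-view : ∀ x → χ-View x
  χ-view x with x Fin.≟ 0ₚ p | isSquare? p x
  ... | yes x≡0 | _      = at-zero x≡0 (χ-zero x≡0)
  ... | no x≢0  | yes sq = square x≢0 sq (χ-square x≢0 sq)
  ... | no x≢0  | no ¬sq = nonsquare x≢0 ¬sq (χ-nonsquare x≢0 ¬sq)

  toℕ≉0 : ∀ {x} → x ≢ 0ₚ p → ¬ + toℕ x ≈ 0ℤ
  toℕ≉0 x≢0 x≈0 = x≢0 (toℕ-≈-injective (ℤₚ.trans x≈0 (ℤₚ.sym toℕ-0)))

  small-multiple : ∀ {a} → 0ℤ ≤ a → a < + p → a ≈ 0ℤ → a ≡ 0ℤ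
  small-multiple {+ zero}  _ _         _   = refl
  small-multiple {+ suc n} _ (+<+ n<p) a≈0 = contradiction a≈0 (<p⇒≉0 pp n<p)

  x*x≈1 : ∀ a → a * a ≈ 1ℤ → a ≈ 1ℤ ⊎ a ≈ -1ℤ
  x*x≈1 a a²≈1 = [ inj₁ ∘ -≈0⇒≈ , inj₂ ∘ -≈0⇒≈ ]′ (*≈0 pp (a - 1ℤ) (a - -1ℤ) product≈0)
    where
    ring : ∀ a → (a - 1ℤ) * (a - -1ℤ) ≡ a * a - 1ℤ
    ring = solve-∀
    product≈0 : (a - 1ℤ) * (a - -1ℤ) ≈ 0ℤ
    product≈0 = ℤₚ.begin
      (a - 1ℤ) * (a - -1ℤ)  ℤₚ.≡⟨ ring a ⟩
      a * a - 1ℤ            ℤₚ.≈⟨ ℤₚ.+-congʳ { -1ℤ} a²≈1 ⟩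
      0ℤ                    ℤₚ.∎

  -- This is p = 4t + 3 written as 2h + 1 with h = 2t + 1: the exponent p - 1 appears as h + h, and
  -- h is visibly odd.
  module _ {t : ℕ} (p≡ : p ≡ suc (suc (t ℕ.+ t) ℕ.+ suc (t ℕ.+ t))) where

    private
      h : ℕ
      h = suc (t ℕ.+ t)

    -- If x^h ≈ 1 then x is the square of x^((p+1)/4), because (p+1)/2 = h + 1.
    euler : ∀ x → χ p x ≈ (+ toℕ x) ^ h
    euler x with χ-view x
    ... | at-zero refl χ≡0 = ℤₚ.begin
      χ p x              ℤₚ.≡⟨ χ≡0 ⟩
      0ℤ                 ℤₚ.≈⟨ ^-cong-≈ h toℕ-0 ⟨
      (+ toℕ x) ^ h      ℤₚ.∎
    ... | square x≢0 (y , refl) χ≡1 = ℤₚ.begin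
      χ p x                            ℤₚ.≡⟨ χ≡1 ⟩
      1ℤ                               ℤₚ.≈⟨ fermat-unit pp p≡ (toℕ y) y≉0 ⟨
      (+ toℕ y) ^ (h ℕ.+ h)            ℤₚ.≡⟨ [x*x]^n≡x^[n+n] (+ toℕ y) h ⟨
      (+ toℕ y * + toℕ y) ^ h          ℤₚ.≡⟨ cong (_^ h) (pos-* (toℕ y) (toℕ y)) ⟨
      (+ (toℕ y ℕ.* toℕ y)) ^ h        ℤₚ.≈⟨ ^-cong-≈ h (toℕ-mod (toℕ y ℕ.* toℕ y)) ⟨
      (+ toℕ x) ^ h                    ℤₚ.∎
      where
      y≉0 : ¬ + toℕ y ≈ 0ℤ
      y≉0 y≈0 = toℕ≉0 x≢0 (ℤₚ.begin
        + toℕ x               ℤₚ.≈⟨ toℕ-mod (toℕ y ℕ.* toℕ y) ⟩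
        + (toℕ y ℕ.* toℕ y)   ℤₚ.≡⟨ pos-* (toℕ y) (toℕ y) ⟩
        + toℕ y * + toℕ y     ℤₚ.≈⟨ ℤₚ.*-congʳ {+ toℕ y} y≈0 ⟩
        0ℤ * + toℕ y          ℤₚ.≡⟨ *-zeroˡ (+ toℕ y) ⟩
        0ℤ                    ℤₚ.∎)
    ... | nonsquare x≢0 ¬sq χ≡-1 = ℤₚ.trans (ℤₚ.reflexive χ≡-1)
      (ℤₚ.sym ([ (λ x^h≈1 → contradiction (y , toℕ-≈-injective (y²≈x x^h≈1)) ¬sq) , id ]′ (x*x≈1 ((+ toℕ x) ^ h) x^2h≈1)))
      where
      r = toℕ x ℕ.^ suc t
      y : Fin p
      y = r ℕ.mod p
      exponent : suc t ℕ.+ suc t ≡ suc h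
      exponent = cong suc (ℕ.+-suc t t)
      x^2h≈1 : (+ toℕ x) ^ h * (+ toℕ x) ^ h ≈ 1ℤ
      x^2h≈1 = ℤₚ.trans (ℤₚ.reflexive (sym (^-homo-* (+ toℕ x) h h))) (fermat-unit pp p≡ (toℕ x) (toℕ≉0 x≢0))
      y²≈x : (+ toℕ x) ^ h ≈ 1ℤ → + toℕ ((toℕ y ℕ.* toℕ y) ℕ.mod p) ≈ + toℕ x
      y²≈x x^h≈1 = ℤₚ.begin
        + toℕ ((toℕ y ℕ.* toℕ y) ℕ.mod p)  ℤₚ.≈⟨ toℕ-mod (toℕ y ℕ.* toℕ y) ⟩
        + (toℕ y ℕ.* toℕ y)                ℤₚ.≡⟨ pos-* (toℕ y) (toℕ y) ⟩
        + toℕ y * + toℕ y                  ℤₚ.≈⟨ ℤₚ.*-cong (toℕ-mod r) (toℕ-mod r) ⟩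
        + r * + r                          ℤₚ.≡⟨ cong (λ z → z * z) (pos-^ (toℕ x) (suc t)) ⟩
        (+ toℕ x) ^ suc t * (+ toℕ x) ^ suc t  ℤₚ.≡⟨ ^-homo-* (+ toℕ x) (suc t) (suc t) ⟨
        (+ toℕ x) ^ (suc t ℕ.+ suc t)      ℤₚ.≡⟨ cong ((+ toℕ x) ^_) exponent ⟩
        + toℕ x * (+ toℕ x) ^ h            ℤₚ.≈⟨ ℤₚ.*-congˡ {+ toℕ x} x^h≈1 ⟩
        + toℕ x * 1ℤ                       ℤₚ.≡⟨ *-identityʳ (+ toℕ x) ⟩
        + toℕ x                            ℤₚ.∎

    -- With U the number of disagreements, N + 2U = p - 1. From N ≈ -1 it follows that p divides 2U,
    -- hence U since p is odd. As f and χ agree at 0, U < p, so U = 0.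
    agree : ∀ (f : Fin p → ℤ) → f (0ₚ p) ≡ 0ℤ → (∀ {x} → x ≢ 0ₚ p → IsSign (f x)) →
      ∑[ x < p ] (f x * χ p x) ≈ -1ℤ → ∀ x → f x ≡ χ p x
    agree f f0≡0 f-sign corr≈-1 x = 1-ind≡0⇒ (f x ≟ χ p x) (∑-nonneg-zero 0≤differ differ≡0 x)
      where
      same differ origin : Fin p → ℤ
      same   y = ind (f y ≟ χ p y)
      differ y = 1ℤ - same y
      origin y = ind (y Fin.≟ 0ₚ p)

      0≤same : ∀ y → 0ℤ ≤ same y
      0≤same y = 0≤ind (f y ≟ χ p y)

      0≤differ : ∀ y → 0ℤ ≤ differ y
      0≤differ y = 0≤1-ind (f y ≟ χ p y)

      same[0]≡1 : same (0ₚ p) ≡ 1ℤ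
      same[0]≡1 with χ-view (0ₚ p)
      ... | at-zero _ χ≡0       = ind-yes (f (0ₚ p) ≟ χ p (0ₚ p)) (trans f0≡0 (sym χ≡0))
      ... | square 0≢0 _ _      = contradiction refl 0≢0
      ... | nonsquare 0≢0 _ _   = contradiction refl 0≢0

      sign-product : ∀ {a b} → IsSign a → IsSign b → a * b + + 2 * (1ℤ - ind (a ≟ b)) ≡ 1ℤ
      sign-product (inj₁ refl) (inj₁ refl) = refl
      sign-product (inj₁ refl) (inj₂ refl) = refl
      sign-product (inj₂ refl) (inj₁ refl) = refl
      sign-product (inj₂ refl) (inj₂ refl) = refl

      -- Two signs a, b satisfy ab = 1 - 2[a ≠ b]. At the origin both functions are zero and agree,
      -- so the left side is 0, which `origin` corrects for.
      pointwise : ∀ y → f y * χ p y + + 2 * differ y ≡ 1ℤ - origin y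
      pointwise y with χ-view y
      ... | at-zero y≡0 χ≡0      = trans
        (cong₂ (λ a b → a * b + + 2 * (1ℤ - ind (a ≟ b))) (trans (cong f y≡0) f0≡0) χ≡0)
        (cong (λ i → 1ℤ - i) (sym (ind-yes (y Fin.≟ 0ₚ p) y≡0)))
      ... | square y≢0 _ χ≡1     = trans (sign-product (f-sign y≢0) (inj₁ χ≡1))
        (cong (λ i → 1ℤ - i) (sym (ind-no (y Fin.≟ 0ₚ p) y≢0)))
      ... | nonsquare y≢0 _ χ≡-1 = trans (sign-product (f-sign y≢0) (inj₂ χ≡-1))
        (cong (λ i → 1ℤ - i) (sym (ind-no (y Fin.≟ 0ₚ p) y≢0)))

      p≈0 : + p ≈ 0ℤ
      p≈0 = ∣⇒≈0 ℕ.∣-refl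

      origin≈0 : ∀ y → y ≢ 0ₚ p → origin y ≈ 0ℤ
      origin≈0 y y≢0 = ℤₚ.reflexive (ind-no (y Fin.≟ 0ₚ p) y≢0)

      N = ∑[ y < p ] (f y * χ p y)
      U = sum differ
      W = sum same

      2U≈0 : + 2 * U ≈ 0ℤ
      2U≈0 = ℤₚ.begin
        + 2 * U                                     ℤₚ.≡⟨ ring N U ⟩
        (N + + 2 * U) - N
          ℤₚ.≡⟨ cong (λ z → (N + z) - N) (*-distribˡ-sum {p} (+ 2) differ) ⟩
        (N + ∑[ y < p ] (+ 2 * differ y)) - N
          ℤₚ.≡⟨ cong (_- N) (∑-distrib-+ {p} (λ y → f y * χ p y) (λ y → + 2 * differ y)) ⟨
        ∑[ y < p ] (f y * χ p y + + 2 * differ y) - N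
          ℤₚ.≡⟨ cong (_- N) (trans (sum-cong-≗ {p} pointwise) (∑-distrib-+ {p} (λ _ → 1ℤ) (λ y → - origin y))) ⟩
        (∑[ y < p ] 1ℤ + ∑[ y < p ] (- origin y)) - N  ℤₚ.≈⟨ ℤₚ.+-cong (ℤₚ.+-cong
                                                         (ℤₚ.trans (ℤₚ.reflexive (trans (∑-const p 1ℤ) (*-identityʳ (+ p)))) p≈0)
                                                         (∑-single (λ y → - origin y) (0ₚ p) λ y y≢0 → ℤₚ.-‿cong (origin≈0 y y≢0)))
                                                         (ℤₚ.-‿cong corr≈-1) ⟩
        (0ℤ + - origin (0ₚ p)) - -1ℤ
          ℤₚ.≡⟨ cong (λ z → (0ℤ + - z) - -1ℤ) (ind-yes (0ₚ p Fin.≟ 0ₚ p) refl) ⟩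
        0ℤ                                          ℤₚ.∎
        where
        ring : ∀ n u → + 2 * u ≡ (n + + 2 * u) - n
        ring = solve-∀

      U≈0 : U ≈ 0ℤ
      U≈0 = [ (λ 2≈0 → contradiction 2≈0 (<p⇒≉0 pp 2<p)) , id ]′ (*≈0 pp (+ 2) U 2U≈0)
        where
        2<p : 2 ℕ.< p
        2<p = subst (2 ℕ.<_) (sym (trans p≡ (cong (λ e → suc (suc e)) (ℕ.+-suc (t ℕ.+ t) (t ℕ.+ t))))) (ℕ.s≤s (ℕ.s≤s (ℕ.s≤s ℕ.z≤n)))

      W+U≡p : W + U ≡ + p
      W+U≡p = trans (sym (∑-distrib-+ {p} same differ))
        (trans (sum-cong-≗ {p} λ y → ring (same y)) (trans (∑-const p 1ℤ) (*-identityʳ (+ p))))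
        where
        ring : ∀ s → s + (1ℤ - s) ≡ 1ℤ
        ring = solve-∀

      W≢0 : W ≢ 0ℤ
      W≢0 W≡0 = contradiction (trans (sym same[0]≡1) (∑-nonneg-zero 0≤same W≡0 (0ₚ p))) λ ()

      differ≡0 : U ≡ 0ℤ
      differ≡0 = small-multiple (∑-nonneg 0≤differ) U<p U≈0
        where
        U<p : U < + p
        U<p = subst (U <_) W+U≡p (subst (_< W + U) (+-identityˡ U) (+-monoˡ-< U (≤∧≢⇒< (∑-nonneg 0≤same) (W≢0 ∘ sym))))

    dichotomy : ∀ (f : Fin p → ℤ) → f (0ₚ p) ≡ 0ℤ → (∀ {x} → x ≢ 0ₚ p → IsSign (f x)) →
      (∀ y → ∑[ z < p ] (f z * f (y ⊖ₚ z)) ≈ 1ℤ) →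
      (∀ x → f x ≡ χ p x) ⊎ (∀ x → - f x ≡ χ p x)
    dichotomy f f0≡0 f-sign conv = [ inj₂ ∘ negated , inj₁ ∘ equal ]′ (x*x≈1 M (moment[h]²≈1 pp f conv {h} p≡ ([-1]^odd t)))
      where
      M = moment pp f conv h
      -- The signs look crossed because χ correlates with itself to p - 1 ≈ -1.
      equal : M ≈ -1ℤ → ∀ x → f x ≡ χ p x
      equal M≈-1 = agree f f0≡0 f-sign (ℤₚ.begin
        ∑[ x < p ] (f x * χ p x)             ℤₚ.≈⟨ ∑-cong-≈ {p} (λ x → ℤₚ.*-congˡ {f x} (euler x)) ⟩
        M                                    ℤₚ.≈⟨ M≈-1 ⟩
        -1ℤ                                  ℤₚ.∎)
      negated : M ≈ 1ℤ → ∀ x → - f x ≡ χ p x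
      negated M≈1 = agree (λ x → - f x) (cong (-_) f0≡0) (neg-sign ∘ f-sign) (ℤₚ.begin
        ∑[ x < p ] (- f x * χ p x)           ℤₚ.≈⟨ ∑-cong-≈ {p} (λ x → ℤₚ.*-congˡ { - f x} (euler x)) ⟩
        ∑[ x < p ] (- f x * (+ toℕ x) ^ h)   ℤₚ.≡⟨ sum-cong-≗ {p} (λ x → ring (f x) ((+ toℕ x) ^ h)) ⟩
        ∑[ x < p ] (-1ℤ * (f x * (+ toℕ x) ^ h))  ℤₚ.≡⟨ *-distribˡ-sum {p} -1ℤ (λ x → f x * (+ toℕ x) ^ h) ⟨
        -1ℤ * M                              ℤₚ.≈⟨ ℤₚ.*-congˡ { -1ℤ} M≈1 ⟩
        -1ℤ                                  ℤₚ.∎)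
        where
        ring : ∀ a b → - a * b ≡ -1ℤ * (a * b)
        ring = solve-∀

-- Edges as 4-sets of Pfaffian ±3

-- Signs indexed by a finite type, so that a statement about all sign patterns is decidable by
-- `all?`.
sgn : Fin 2 → ℤ
sgn 0F = 1ℤ
sgn 1F = -1ℤ

matrix₄ : (a b c d e f : ℤ) → Fin 4 → Fin 4 → ℤ
matrix₄ a b c d e f 0F 1F = a
matrix₄ a b c d e f 0F 2F = b
matrix₄ a b c d e f 0F 3F = c
matrix₄ a b c d e f 1F 2F = d
matrix₄ a b c d e f 1F 3F = e
matrix₄ a b c d e f 2F 3F = f
matrix₄ a b c d e f 1F 0F = - a
matrix₄ a b c d e f 2F 0F = - b
matrix₄ a b c d e f 3F 0F = - c
matrix₄ a b c d e f 2F 1F = - d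
matrix₄ a b c d e f 3F 1F = - e
matrix₄ a b c d e f 3F 2F = - f
matrix₄ a b c d e f 0F 0F = 0ℤ
matrix₄ a b c d e f 1F 1F = 0ℤ
matrix₄ a b c d e f 2F 2F = 0ℤ
matrix₄ a b c d e f 3F 3F = 0ℤ

triple : ∀ {A : Set} → (A → A → ℤ) → A → A → A → ℤ
triple s x y z = s x y * s y z * s z x

points₄ : Vec (Fin 4) 4
points₄ = 0F ∷ 1F ∷ 2F ∷ 3F ∷ []

-- Checked by evaluating all 64 sign patterns. The reason behind it is switching: reversing all
-- edges at one point fixes every triple product and negates the Pfaffian, each term of which has
-- exactly one factor at that point. So all edges at one point may be assumed to lead into it; the
-- other three points then form a cyclic triangle, with Pfaffian ±3, or a transitive one, with
-- Pfaffian ±1.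
indicator₄ : ∀ a b c d e f →
  let s = matrix₄ (sgn a) (sgn b) (sgn c) (sgn d) (sgn e) (sgn f) in
  1ℤ + + 8 * ind (isoToG₃? (triple s) points₄) ≡ pfaffian s 0F 1F 2F 3F * pfaffian s 0F 1F 2F 3F
indicator₄ = toWitness {a? = all? λ a → all? λ b → all? λ c → all? λ d → all? λ e → all? λ f → _ ≟ _} tt

-- Isomorphism tests only triples of distinct points, so values on the diagonal, where `e⁺` and the
-- Seidel matrix differ, cannot matter.
isoToG₃-cong : ∀ {m n} {g : Fin m → Fin m → Fin m → ℤ} {g′ : Fin n → Fin n → Fin n → ℤ} (X : Vec (Fin m) 4) (Y : Vec (Fin n) 4) →
  (∀ i j k → i ≢ j → j ≢ k → i ≢ k → g (lookup X i) (lookup X j) (lookup X k) ≡ g′ (lookup Y i) (lookup Y j) (lookup Y k)) →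
  IsoToG₃ g X → IsoToG₃ g′ Y
isoToG₃-cong X Y g≡g′ = Any.map λ (u , pres) → u , λ i j k i≢j j≢k i≢k →
  trans (sym (g≡g′ i j k i≢j j≢k i≢k)) (pres i j k i≢j j≢k i≢k)

lookup-points₄ : ∀ i → lookup points₄ i ≡ i
lookup-points₄ 0F = refl
lookup-points₄ 1F = refl
lookup-points₄ 2F = refl
lookup-points₄ 3F = refl

sgn-surjective : ∀ {i} → IsSign i → ∃ λ b → i ≡ sgn b
sgn-surjective (inj₁ refl) = 0F , refl
sgn-surjective (inj₂ refl) = 1F , refl

if-sign : ∀ {i} → IsSign i → (if ⌊ i ≟ 1ℤ ⌋ then 1ℤ else -1ℤ) ≡ i
if-sign (inj₁ refl) = refl
if-sign (inj₂ refl) = refl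

ind≡⇒ : ∀ {a b} {P : Set a} {Q : Set b} (P? : Dec P) (Q? : Dec Q) → 1ℤ + + 8 * ind P? ≡ 1ℤ + + 8 * ind Q? → P → Q
ind≡⇒ (yes _) (yes q) _ _ = q
ind≡⇒ (no ¬p) _       _ p = contradiction p ¬p

module _ (s : Fin 4 → Fin 4 → ℤ) (skew : ∀ i j → s i j ≡ - s j i) (sign : ∀ {i j} → i Fin.< j → IsSign (s i j)) where

  private
    entries : Fin 4 → Fin 4 → ℤ
    entries = matrix₄ (s 0F 1F) (s 0F 2F) (s 0F 3F) (s 1F 2F) (s 1F 3F) (s 2F 3F)

    entries≡ : ∀ i j → i ≢ j → s i j ≡ entries i j
    entries≡ 0F 1F _ = refl
    entries≡ 0F 2F _ = refl
    entries≡ 0F 3F _ = refl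
    entries≡ 1F 2F _ = refl
    entries≡ 1F 3F _ = refl
    entries≡ 2F 3F _ = refl
    entries≡ 1F 0F _ = skew 1F 0F
    entries≡ 2F 0F _ = skew 2F 0F
    entries≡ 3F 0F _ = skew 3F 0F
    entries≡ 2F 1F _ = skew 2F 1F
    entries≡ 3F 1F _ = skew 3F 1F
    entries≡ 3F 2F _ = skew 3F 2F
    entries≡ 0F 0F i≢i = contradiction refl i≢i
    entries≡ 1F 1F i≢i = contradiction refl i≢i
    entries≡ 2F 2F i≢i = contradiction refl i≢i
    entries≡ 3F 3F i≢i = contradiction refl i≢i

    triple≡ : ∀ i j k → i ≢ j → j ≢ k → i ≢ k → triple s i j k ≡ triple entries i j k
    triple≡ i j k i≢j j≢k i≢k =
      cong₂ _*_ (cong₂ _*_ (entries≡ i j i≢j) (entries≡ j k j≢k)) (entries≡ k i (i≢k ∘ sym))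

    entries-indicator : ∀ {a b c d e f} → IsSign a → IsSign b → IsSign c → IsSign d → IsSign e → IsSign f →
      let m = matrix₄ a b c d e f in
      1ℤ + + 8 * ind (isoToG₃? (triple m) points₄) ≡ pfaffian m 0F 1F 2F 3F * pfaffian m 0F 1F 2F 3F
    entries-indicator a± b± c± d± e± f±
      with sgn-surjective a± | sgn-surjective b± | sgn-surjective c± | sgn-surjective d± | sgn-surjective e± | sgn-surjective f±
    ... | a , refl | b , refl | c , refl | d , refl | e , refl | f , refl = indicator₄ a b c d e f

  isoToG₃-indicator : ∀ {n} (g : Fin n → Fin n → Fin n → ℤ) (X : Vec (Fin n) 4) →
    (∀ i j k → i ≢ j → j ≢ k → i ≢ k → g (lookup X i) (lookup X j) (lookup X k) ≡ triple s i j k) →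
    1ℤ + + 8 * ind (isoToG₃? g X) ≡ pfaffian s 0F 1F 2F 3F * pfaffian s 0F 1F 2F 3F
  isoToG₃-indicator g X g≡s = trans
    (cong (λ t → 1ℤ + + 8 * t) (ind-⇔ (isoToG₃? g X) (isoToG₃? (triple entries) points₄)
      (isoToG₃-cong {g = g} {g′ = triple entries} X points₄ g≡entries)
      (isoToG₃-cong {g = triple entries} {g′ = g} points₄ X λ i j k i≢j j≢k i≢k → sym (g≡entries i j k i≢j j≢k i≢k))))
    (entries-indicator (sign (ℕ.s≤s ℕ.z≤n)) (sign (ℕ.s≤s ℕ.z≤n)) (sign (ℕ.s≤s ℕ.z≤n))
      (sign (ℕ.s≤s (ℕ.s≤s ℕ.z≤n))) (sign (ℕ.s≤s (ℕ.s≤s ℕ.z≤n))) (sign (ℕ.s≤s (ℕ.s≤s (ℕ.s≤s ℕ.z≤n)))))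
    where
    g≡entries : ∀ i j k → i ≢ j → j ≢ k → i ≢ k → g (lookup X i) (lookup X j) (lookup X k) ≡
      triple entries (lookup points₄ i) (lookup points₄ j) (lookup points₄ k)
    g≡entries i j k i≢j j≢k i≢k rewrite lookup-points₄ i | lookup-points₄ j | lookup-points₄ k =
      trans (g≡s i j k i≢j j≢k i≢k) (triple≡ i j k i≢j j≢k i≢k)

lookup-mono : ∀ {n} {X : Vec (Fin n) 4} → IsSet X → ∀ {i j} → i Fin.< j → lookup X i Fin.< lookup X j
lookup-mono {X = X} X-set = go X X-set
  where
  head< : ∀ {k n} {x : Fin n} (v : Vec (Fin n) k) → IsSet (x ∷ v) → ∀ i → x Fin.< lookup v i
  head< (y ∷ v) (x<y ∷ s) zero    = x<y
  head< (y ∷ v) (x<y ∷ s) (suc i) = Fin.<-trans x<y (head< v s i)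
  go : ∀ {k n} (v : Vec (Fin n) k) → IsSet v → ∀ {i j} → i Fin.< j → lookup v i Fin.< lookup v j
  go (x ∷ v) s {zero}  {suc j} _            = head< v s j
  go (x ∷ v) s {suc i} {suc j} (ℕ.s≤s i<j)  = go v (isSet-tail v s) i<j

-- The Seidel matrix of the augmented tournament and the final comparison

module Tournament (p : ℕ) .{{_ : NonZero p}} where
  open Modular p
  open Residues p

  seidel : (Fin p → ℤ) → V p → V p → ℤ
  seidel f zero    zero    = 0ℤ
  seidel f zero    (suc y) = -1ℤ
  seidel f (suc x) zero    = 1ℤ
  seidel f (suc x) (suc y) = f (y ⊖ₚ x)

  x⊖x≡0 : ∀ x → x ⊖ₚ x ≡ 0ₚ p
  x⊖x≡0 x = toℕ-≈-injective (ℤₚ.trans (toℕ-- x x) (ℤₚ.trans (ℤₚ.reflexive (+-inverseʳ (+ toℕ x))) (ℤₚ.sym toℕ-0)))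

  x⊖0≡x : ∀ x → x ⊖ₚ 0ₚ p ≡ x
  x⊖0≡x x = toℕ-≈-injective (ℤₚ.trans (toℕ-- x (0ₚ p)) (ℤₚ.trans (ℤₚ.+-congˡ {+ toℕ x} (ℤₚ.-‿cong toℕ-0)) (ℤₚ.reflexive (+-identityʳ (+ toℕ x)))))

  x⊖y≡0⇒x≡y : ∀ {x y} → x ⊖ₚ y ≡ 0ₚ p → x ≡ y
  x⊖y≡0⇒x≡y {x} {y} x⊖y≡0 = toℕ-≈-injective (-≈0⇒≈ (ℤₚ.trans (ℤₚ.sym (toℕ-- x y)) (ℤₚ.trans (ℤₚ.reflexive (cong (+_ ∘ toℕ) x⊖y≡0)) toℕ-0)))

  neg-⊖ : ∀ x y → negₚ p (x ⊖ₚ y) ≡ y ⊖ₚ x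
  neg-⊖ x y = toℕ-≈-injective (ℤₚ.begin
    + toℕ (negₚ p (x ⊖ₚ y))   ℤₚ.≈⟨ toℕ-neg (x ⊖ₚ y) ⟩
    - + toℕ (x ⊖ₚ y)          ℤₚ.≈⟨ ℤₚ.-‿cong (toℕ-- x y) ⟩
    - (+ toℕ x - + toℕ y)     ℤₚ.≡⟨ ring (+ toℕ x) (+ toℕ y) ⟩
    + toℕ y - + toℕ x         ℤₚ.≈⟨ toℕ-- y x ⟨
    + toℕ (y ⊖ₚ x)            ℤₚ.∎)
    where
    ring : ∀ x y → - (x - y) ≡ y - x
    ring = solve-∀

  admissible-neg : ∀ {f} → Admissible p f → Admissible p (λ x → - f x)
  admissible-neg {f} (values , zeros , odd) =
      (λ a → [ inj₁ ∘ cong (-_) , [ inj₂ ∘ inj₂ ∘ cong (-_) , inj₂ ∘ inj₁ ∘ cong (-_) ]′ ]′ (values a))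
    , (λ a → (λ -fa≡0 → proj₁ (zeros a) (neg-injective {f a} {0ℤ} -fa≡0)) , (cong (-_) ∘ proj₂ (zeros a)))
    , (cong (-_) ∘ odd)

  -- Once f or its negative is known to equal χ, this carries admissibility over to χ, as
  -- `edge-indicator` demands for both functions.
  admissible-resp : ∀ {f f′} → (∀ x → f x ≡ f′ x) → Admissible p f → Admissible p f′
  admissible-resp f≗f′ (values , zeros , odd) =
      (λ a → subst (λ i → i ≡ + 0 ⊎ i ≡ + 1 ⊎ i ≡ - (+ 1)) (f≗f′ a) (values a))
    , (λ a → (λ f′a≡0 → proj₁ (zeros a) (trans (f≗f′ a) f′a≡0)) , (λ a≡0 → trans (sym (f≗f′ a)) (proj₂ (zeros a) a≡0)))
    , (λ a → trans (sym (f≗f′ (negₚ p a))) (trans (odd a) (cong (-_) (f≗f′ a))))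

  module _ (f : Fin p → ℤ) (f-adm : Admissible p f) where

    f[0]≡0 : f (0ₚ p) ≡ 0ℤ
    f[0]≡0 = proj₂ (proj₁ (proj₂ f-adm) (0ₚ p)) refl

    f-sign : ∀ {x} → x ≢ 0ₚ p → IsSign (f x)
    f-sign {x} x≢0 = [ (λ fx≡0 → contradiction (proj₁ (proj₁ (proj₂ f-adm) x) fx≡0) x≢0) , id ]′ (proj₁ f-adm x)

    f-odd : ∀ x y → f (y ⊖ₚ x) ≡ - f (x ⊖ₚ y)
    f-odd x y = trans (cong f (sym (neg-⊖ x y))) (proj₂ (proj₂ f-adm) (x ⊖ₚ y))

    seidel-sign : ∀ {i j} → i ≢ j → IsSign (seidel f i j)
    seidel-sign {zero}  {zero}  i≢j = contradiction refl i≢j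
    seidel-sign {zero}  {suc y} i≢j = inj₂ refl
    seidel-sign {suc x} {zero}  i≢j = inj₁ refl
    seidel-sign {suc x} {suc y} i≢j = f-sign λ y⊖x≡0 → i≢j (cong suc (sym (x⊖y≡0⇒x≡y y⊖x≡0)))

    seidel-isSkewSign : IsSkewSign (seidel f)
    seidel-isSkewSign = record { skew = skew ; diag = diag ; unit = λ i≢j → sign² (seidel-sign i≢j) }
      where
      skew : ∀ i j → seidel f i j ≡ - seidel f j i
      skew zero    zero    = refl
      skew zero    (suc y) = refl
      skew (suc x) zero    = refl
      skew (suc x) (suc y) = f-odd x y
      diag : ∀ i → seidel f i i ≡ 0ℤ
      diag zero    = refl
      diag (suc x) = trans (cong f (x⊖x≡0 x)) f[0]≡0
      sign² : ∀ {i} → IsSign i → i * i ≡ 1ℤ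
      sign² (inj₁ refl) = refl
      sign² (inj₂ refl) = refl

    e⁺≡seidel : ∀ i j → i ≢ j → e⁺ p f i j ≡ seidel f i j
    e⁺≡seidel zero    zero    i≢j = contradiction refl i≢j
    e⁺≡seidel zero    (suc y) i≢j = refl
    e⁺≡seidel (suc x) zero    i≢j = refl
    e⁺≡seidel (suc x) (suc y) i≢j = if-sign (seidel-sign i≢j)

    edge-indicator : ∀ X → IsSet X → 1ℤ + + 8 * ind (edgeH? p f X) ≡ pfaffian² (seidel f) X
    -- X is split into its four entries because `pfaffian²` computes only on an explicit vector; the
    -- lookups then reduce to these entries.
    edge-indicator X@(x₀ ∷ x₁ ∷ x₂ ∷ x₃ ∷ []) X-set = isoToG₃-indicator (λ i j → seidel f (lookup X i) (lookup X j))
      (λ i j → IsSkewSign.skew seidel-isSkewSign (lookup X i) (lookup X j))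
      (λ i<j → seidel-sign (Fin.<⇒≢ (lookup-mono {X = X} X-set i<j)))
      (g⁺ p f) X
      (λ i j k i≢j j≢k i≢k → cong₂ _*_ (cong₂ _*_ (e i j i≢j) (e j k j≢k)) (e k i (i≢k ∘ sym)))
      where
      lookup-injective : ∀ i j → lookup X i ≡ lookup X j → i ≡ j
      lookup-injective i j eq with Fin.<-cmp i j
      ... | tri< i<j _ _ = contradiction eq (Fin.<⇒≢ (lookup-mono {X = X} X-set i<j))
      ... | tri≈ _ i≡j _ = i≡j
      ... | tri> _ _ j<i = contradiction (sym eq) (Fin.<⇒≢ (lookup-mono {X = X} X-set j<i))
      e : ∀ i j → i ≢ j → e⁺ p f (lookup X i) (lookup X j) ≡ seidel f (lookup X i) (lookup X j)
      e i j i≢j = e⁺≡seidel (lookup X i) (lookup X j) (i≢j ∘ lookup-injective i j)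

    -- In the entry of S² at (0, y) the middle point ∞ contributes 1 · (-1) and a middle point z of
    -- F_p contributes f(z) f(y - z). The convolution is thus 1 plus that entry, which is 0 for y ≠
    -- 0 and -p for y = 0.
    convolution : 16 ℕ.* numEdges p f ≡ suc p ℕ.* (suc p C 3) → ∀ y → ∑[ z < p ] (f z * f (y ⊖ₚ z)) ≈ 1ℤ
    convolution E-max y = ℤₚ.begin
      ∑[ z < p ] (f z * f (y ⊖ₚ z))
        ℤₚ.≡⟨ ring (∑[ z < p ] (f z * f (y ⊖ₚ z))) ⟩
      1ℤ + (-1ℤ + ∑[ z < p ] (f z * f (y ⊖ₚ z)))
        ℤₚ.≡⟨ cong (λ t → 1ℤ + (-1ℤ + t)) (sum-cong-≗ {p} λ z → cong (λ x → f x * f (y ⊖ₚ z)) (x⊖0≡x z)) ⟨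
      1ℤ + S² seidel-isSkewSign (suc (0ₚ p)) (suc y)
        ℤₚ.≈⟨ S²-row (0ₚ p Fin.≟ y) ⟩
      1ℤ ℤₚ.∎
      where
      ring : ∀ k → k ≡ 1ℤ + (-1ℤ + k)
      ring = solve-∀
      pf-count : sumSubsets 4 (pfaffian² (seidel f)) ≡ + (suc p C 4) + + 8 * + numEdges p f
      pf-count = sumSubsets-indicator 4 (suc p) (edgeH? p f) (+ 8) edge-indicator
      E-maxℤ : + 16 * + numEdges p f ≡ + suc p * + (suc p C 3)
      E-maxℤ = trans (sym (pos-* 16 (numEdges p f))) (trans (cong +_ E-max) (pos-* (suc p) (suc p C 3)))
      S²-row : Dec (0ₚ p ≡ y) → 1ℤ + S² seidel-isSkewSign (suc (0ₚ p)) (suc y) ≈ 1ℤ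
      S²-row (yes refl) = ℤₚ.begin
        1ℤ + S² seidel-isSkewSign (suc (0ₚ p)) (suc y)
          ℤₚ.≡⟨ cong (_+_ 1ℤ) (S²-diag seidel-isSkewSign (suc (0ₚ p))) ⟩
        1ℤ - + p                                        ℤₚ.≈⟨ ℤₚ.+-congˡ {1ℤ} (ℤₚ.-‿cong (∣⇒≈0 ℕ.∣-refl)) ⟩
        1ℤ                                              ℤₚ.∎
      S²-row (no 0≢y) = ℤₚ.reflexive (cong (_+_ 1ℤ)
        (S²-off-diagonal seidel-isSkewSign (+ numEdges p f) pf-count E-maxℤ (0≢y ∘ Fin.suc-injective)))

  -- If ∞ is absent, both factors of each term change sign and the Pfaffian stays. If ∞ is present,
  -- the factor at ∞ is kept and the other is negated, so the Pfaffian changes sign. In an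
  -- increasing tuple ∞, being `zero`, can only come first.
  pfaffian²-neg : ∀ {f f′} → (∀ x → - f x ≡ f′ x) → ∀ X → IsSet X → pfaffian² (seidel f) X ≡ pfaffian² (seidel f′) X
  pfaffian²-neg {f} {f′} -f≗f′ (zero ∷ suc x₁ ∷ suc x₂ ∷ suc x₃ ∷ []) _
    rewrite sym (-f≗f′ (x₂ ⊖ₚ x₁)) | sym (-f≗f′ (x₃ ⊖ₚ x₁)) | sym (-f≗f′ (x₃ ⊖ₚ x₂)) =
    ring (f (x₂ ⊖ₚ x₁)) (f (x₃ ⊖ₚ x₁)) (f (x₃ ⊖ₚ x₂))
    where
    ring : ∀ a b c → (-1ℤ * c - -1ℤ * b + -1ℤ * a) * (-1ℤ * c - -1ℤ * b + -1ℤ * a) ≡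
      (-1ℤ * - c - -1ℤ * - b + -1ℤ * - a) * (-1ℤ * - c - -1ℤ * - b + -1ℤ * - a)
    ring = solve-∀
  pfaffian²-neg {f} {f′} -f≗f′ (suc x₀ ∷ suc x₁ ∷ suc x₂ ∷ suc x₃ ∷ []) _
    rewrite sym (-f≗f′ (x₁ ⊖ₚ x₀)) | sym (-f≗f′ (x₂ ⊖ₚ x₀)) | sym (-f≗f′ (x₃ ⊖ₚ x₀))
          | sym (-f≗f′ (x₂ ⊖ₚ x₁)) | sym (-f≗f′ (x₃ ⊖ₚ x₁)) | sym (-f≗f′ (x₃ ⊖ₚ x₂)) =
    ring (f (x₁ ⊖ₚ x₀)) (f (x₂ ⊖ₚ x₀)) (f (x₃ ⊖ₚ x₀)) (f (x₂ ⊖ₚ x₁)) (f (x₃ ⊖ₚ x₁)) (f (x₃ ⊖ₚ x₂))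
    where
    ring : ∀ ab ac ad bc bd cd → (ab * cd - ac * bd + ad * bc) * (ab * cd - ac * bd + ad * bc) ≡
      (- ab * - cd - - ac * - bd + - ad * - bc) * (- ab * - cd - - ac * - bd + - ad * - bc)
    ring = solve-∀
  pfaffian²-neg _ (_ ∷ zero ∷ _) (() ∷ _)
  pfaffian²-neg _ (_ ∷ _ ∷ zero ∷ _) (_ ∷ () ∷ _)
  pfaffian²-neg _ (_ ∷ _ ∷ _ ∷ zero ∷ []) (_ ∷ _ ∷ () ∷ _)

  seidel-resp : ∀ {f f′} → (∀ x → f x ≡ f′ x) → ∀ i j → seidel f i j ≡ seidel f′ i j
  seidel-resp f≗f′ zero    zero    = refl
  seidel-resp f≗f′ zero    (suc y) = refl
  seidel-resp f≗f′ (suc x) zero    = refl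
  seidel-resp f≗f′ (suc x) (suc y) = f≗f′ (y ⊖ₚ x)

  pfaffian²-resp : ∀ {f f′} → (∀ x → f x ≡ f′ x) → ∀ X → pfaffian² (seidel f) X ≡ pfaffian² (seidel f′) X
  pfaffian²-resp f≗f′ (a ∷ b ∷ c ∷ d ∷ []) = cong (λ t → t * t) (cong₂ _+_
    (cong₂ _-_ (cong₂ _*_ (s≗ a b) (s≗ c d)) (cong₂ _*_ (s≗ a c) (s≗ b d))) (cong₂ _*_ (s≗ a d) (s≗ b c)))
    where s≗ = seidel-resp f≗f′

  edges-equal : ∀ {f f′} → Admissible p f → Admissible p f′ → ∀ X → IsSet X →
    pfaffian² (seidel f) X ≡ pfaffian² (seidel f′) X → (EdgeH p f X → EdgeH p f′ X) × (EdgeH p f′ X → EdgeH p f X)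
  edges-equal {f} {f′} f-adm f′-adm X X-set pf²≡ =
    ind≡⇒ (edgeH? p f X) (edgeH? p f′ X) same , ind≡⇒ (edgeH? p f′ X) (edgeH? p f X) (sym same)
    where
    same : 1ℤ + + 8 * ind (edgeH? p f X) ≡ 1ℤ + + 8 * ind (edgeH? p f′ X)
    same = trans (edge-indicator f f-adm X X-set) (trans pf²≡ (sym (edge-indicator f′ f′-adm X X-set)))

  f≡±χ⇒edges-equal : ∀ {f} → Admissible p f → (∀ x → f x ≡ χ p x) ⊎ (∀ x → - f x ≡ χ p x) →
    ∀ X → IsSet X → (EdgeH p f X → EdgeH p (χ p) X) × (EdgeH p (χ p) X → EdgeH p f X)
  f≡±χ⇒edges-equal f-adm (inj₁ f≗χ) X X-set =
    edges-equal f-adm (admissible-resp f≗χ f-adm) X X-set (pfaffian²-resp f≗χ X)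
  f≡±χ⇒edges-equal f-adm (inj₂ -f≗χ) X X-set =
    edges-equal f-adm (admissible-resp -f≗χ (admissible-neg f-adm)) X X-set (pfaffian²-neg -f≗χ X X-set)

theorem5p1 : (p : ℕ) .{{_ : NonZero p}} → Prime p → p % 4 ≡ 3 →
    (f : Fin p → ℤ) → Admissible p f →
    H4Free p f →
    16 ℕ.* numEdges p f ≡ suc p ℕ.* (suc p C 3) →
    (X : Vec (V p) 4) → IsSet X → (EdgeH p f X → EdgeH p (χ p) X) × (EdgeH p (χ p) X → EdgeH p f X)
theorem5p1 p pp p%4≡3 f f-adm _ E-max = f≡±χ⇒edges-equal f-adm
  (QuadraticCharacter.dichotomy p pp {p ℕ./ 4} p≡ f (f[0]≡0 f f-adm) (f-sign f f-adm) (convolution f f-adm E-max))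
  where
  open Tournament p
  ring : ∀ t → 3 ℕ.+ t ℕ.* 4 ≡ suc (suc (t ℕ.+ t) ℕ.+ suc (t ℕ.+ t))
  ring = ℕ-RingSolver.solve-∀
  p≡ : p ≡ suc (suc (p ℕ./ 4 ℕ.+ p ℕ./ 4) ℕ.+ suc (p ℕ./ 4 ℕ.+ p ℕ./ 4))
  p≡ = trans (ℕ.m≡m%n+[m/n]*n p 4) (trans (cong (ℕ._+ p ℕ./ 4 ℕ.* 4) p%4≡3) (ring (p ℕ./ 4)))
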